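{- Let $n\ge 1$ be a natural number and let $(\mathcal P,\mathcal L)$ be a symmetric $((n^2+n+3)_{n+1})$ configuration (that is, of deficiency $k=3$). Suppose that its lines are partitioned into $m$ cycles of lines in which consecutive lines are non-intersecting. Then either the configuration is (isomorphic to) configuration $9.1$, or $m$ is odd.
   Context: A symmetric $(v_r)$ configuration is a pair $(\mathcal P,\mathcal L)$ where $\mathcal P$ is a finite set of $v$ points, $v\ge 3$, and $\mathcal L$ is a set of $v$ lines, each line being a subset of $\mathcal P$, such that each line contains exactly $r$ points, each point lies on exactly $r$ lines, and any two distinct points lie together on at most one line (equivalently, any two distinct lines share at most one point). Configurations are assumed connected: $\mathcal P$ cannot be split into two nonempty parts such that every line lies inside one of the parts. A $((n^2+n+k)_{n+1})$ configuration is a symmetric $(v_r)$ configuration with $v=n^2+n+k$ and $r=n+1$; $k$ is called its deficiency. Two lines are parallel (non-intersecting) if they have no point in common. When $k=3$, every line is non-intersecting with exactly two other lines, so the graph whose vertices are the lines, with two distinct lines adjacent when they are non-intersecting, is $2$-regular and hence a disjoint union of cycles (each of length at least $3$). The partition of the lines into $m$ cycles is this decomposition; $m$ is the number of connected components of the graph. Configuration $9.1$ is the $(9_3)$ configuration with points $0,1,\dots,8$ and lines $\{0,1,2\},\{3,4,5\},\{6,7,8\},\{0,3,6\},\{0,4,7\},\{1,3,7\},\{1,5,8\},\{2,4,8\},\{2,5,6\}$. Two configurations are isomorphic if there is a bijection between their point sets that maps the set of lines of one onto the set of lines of the other. -}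

module Defs where

open import Data.Fin using (Fin; toℕ; #_)
open import Data.Fin.Properties using (all?; _≟_)
open import Data.Fin.Subset
  using (Subset; _∈_; _⊆_; _∩_; _∪_; ∁; ⁅_⁆; ∣_∣; Nonempty; Empty)
open import Data.Fin.Subset.Properties
  using (_∈?_; _⊆?_; nonempty?; anySubset?)
open import Data.Nat using (ℕ; suc; _≤_; s≤s; z≤n)
import Data.Nat.Properties as ℕ
open import Data.Nat.DivMod using (_mod_)
open import Data.Product using (Σ; Σ-syntax; ∃-syntax; _×_; _,_; uncurry)
open import Data.Sum using (_⊎_)
open import Data.Vec using ([]; _∷_; lookup; tabulate)
open import Data.Vec.Properties using (≡-dec)
import Data.Bool.Properties as Bool
open import Function.Bundles using (_↔_; module Inverse)
open import Function.Definitions using (Injective; Bijective)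
open import Relation.Binary.PropositionalEquality using (_≡_; _≢_)
open import Relation.Nullary.Decidable
  using (Dec; ¬?; _×-dec_; _⊎-dec_; _→-dec_; toWitness)
open import Relation.Nullary.Negation using (¬_)

-- The point set is Fin v. The set of lines is listed without repetition by
-- the injection `line`; a line is identified with its index in this list.
record Configuration (v r : ℕ) : Set where
  field
    line           : Fin v → Subset v
    line-injective : Injective _≡_ _≡_ line
    v≥3            : 3 ≤ v

  linesThrough : Fin v → Subset v
  linesThrough p = tabulate λ i → lookup (line i) p

  field
    points-per-line : ∀ i → ∣ line i ∣ ≡ r
    lines-per-point : ∀ p → ∣ linesThrough p ∣ ≡ r
    linear          : ∀ p q → p ≢ q → ∀ i j →
                      p ∈ line i → q ∈ line i → p ∈ line j → q ∈ line j →
                      i ≡ j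
    connected       : ¬ (∃[ S ] Nonempty S × Nonempty (∁ S) ×
                         (∀ i → line i ⊆ S ⊎ line i ⊆ ∁ S))

  Parallel : Fin v → Fin v → Set
  Parallel i j = Empty (line i ∩ line j)

open Configuration

-- Cyclic successor: the last index is followed by the first.
next : ∀ {n} → Fin n → Fin n
next {suc n} i = suc (toℕ i) mod suc n

-- `cycle c` lists the lines of the c-th cycle in cyclic order. Bijectivity says
-- that every line occurs in exactly one cycle, at exactly one position.
record CyclePartition {v r} (C : Configuration v r) (m : ℕ) : Set where
  field
    length      : Fin m → ℕ
    length≥3    : ∀ c → 3 ≤ length c
    cycle       : (c : Fin m) → Fin (length c) → Fin v
    consecutive : ∀ c t → Parallel C (cycle c t) (cycle c (next t))
    partition   : Bijective _≡_ _≡_ (uncurry cycle)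

image : ∀ {v w} → Fin v ↔ Fin w → Subset v → Subset w
image f S = tabulate λ q → lookup S (Inverse.from f q)

-- The two clauses after the bijection are the two inclusions between the image
-- of the set of lines of C and the set of lines of D.
Isomorphic : ∀ {v r w s} → Configuration v r → Configuration w s → Set
Isomorphic {v} {_} {w} C D =
  Σ[ f ∈ (Fin v ↔ Fin w) ]
    (∀ i → ∃[ j ] image f (line C i) ≡ line D j) ×
    (∀ j → ∃[ i ] image f (line C i) ≡ line D j)

line9·1 : Fin 9 → Subset 9
line9·1 = lookup
  ( ⟨ # 0 , # 1 , # 2 ⟩
  ∷ ⟨ # 3 , # 4 , # 5 ⟩
  ∷ ⟨ # 6 , # 7 , # 8 ⟩
  ∷ ⟨ # 0 , # 3 , # 6 ⟩
  ∷ ⟨ # 0 , # 4 , # 7 ⟩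
  ∷ ⟨ # 1 , # 3 , # 7 ⟩
  ∷ ⟨ # 1 , # 5 , # 8 ⟩
  ∷ ⟨ # 2 , # 4 , # 8 ⟩
  ∷ ⟨ # 2 , # 5 , # 6 ⟩
  ∷ [])
  where
  ⟨_,_,_⟩ : Fin 9 → Fin 9 → Fin 9 → Subset 9
  ⟨ a , b , c ⟩ = ⁅ a ⁆ ∪ ⁅ b ⁆ ∪ ⁅ c ⁆

configuration9·1 : Configuration 9 3
configuration9·1 = record
  { line            = line9·1
  ; line-injective  = λ {i} {j} → toWitness
      {a? = all? λ i → all? λ j →
              ≡-dec Bool._≟_ (line9·1 i) (line9·1 j) →-dec (i ≟ j)} _ i j
  ; v≥3             = s≤s (s≤s (s≤s z≤n))
  ; points-per-line = toWitness {a? = all? λ i → ∣ line9·1 i ∣ ℕ.≟ 3} _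
  ; lines-per-point = toWitness
      {a? = all? λ p → ∣ tabulate (λ i → lookup (line9·1 i) p) ∣ ℕ.≟ 3} _
  ; linear          = toWitness
      {a? = all? λ p → all? λ q → ¬? (p ≟ q) →-dec
            (all? λ i → all? λ j →
              (p ∈? line9·1 i) →-dec ((q ∈? line9·1 i) →-dec
              ((p ∈? line9·1 j) →-dec ((q ∈? line9·1 j) →-dec (i ≟ j)))))} _
  ; connected       = toWitness
      {a? = ¬? (anySubset? λ S → nonempty? S ×-dec (nonempty? (∁ S) ×-dec
              (all? λ i → (line9·1 i ⊆? S) ⊎-dec (line9·1 i ⊆? ∁ S))))} _
  }

{-# OPTIONS --safe #-}
-- The incidence matrix N, with the lines ordered along the cycles, satisfies
-- N Nᵗ = (nI − A) + J, where A is the adjacency matrix of the union of cycles.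
-- Border N by a column of ones and add the row (r, 1, …, 1), which is orthogonal
-- to the others for the form −X₀² + X₁² + … + X_v²: the Gram matrix becomes
-- (2 − n) ⊕ (nI − A), so (n − 2) det (nI − A) is a square. Over the ring in which
-- n = x + x⁻¹, the matrix nI − A is also the Gram matrix of the vectors
-- x eᵢ − e_σ(i) for the form x⁻¹ (X₁² + … + X_v²), where σ is the successor along
-- the cycles, and the determinant of these vectors is the product of x^ℓ − 1 over
-- the cycle lengths ℓ. Since v is odd, an even number of cycles would give
-- integers c² = (n² − 4) a² with a ≠ 0, which is impossible when n ≥ 3. For n = 1
-- there is no room for two cycles; for n = 2 an even number of cycles means
-- lengths (3, 6), which forces configuration 9.1, or (4, 5), which is impossible.
-- Determinants are replaced by the exterior algebra with its induced form: the
-- norm of a wedge of vectors depends only on their scalar products.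
module Submission where

open import Defs
open import Algebra.Bundles using (CommutativeRing)
open import Algebra.Consequences.Propositional using (comm∧idˡ⇒id; comm∧distrˡ⇒distrʳ)
import Algebra.Properties.CommutativeSemiring.Exp as CommutativeExp
import Algebra.Properties.Semiring.Exp as Exp
import Algebra.Properties.Semiring.Sum as Sum
open import Algebra.Structures using (IsCommutativeRing)
import Data.Bool as Bool
open import Data.Bool using (true; false; if_then_else_)
import Data.Bool.Properties as Bool
open import Data.Empty using (⊥; ⊥-elim)
open import Data.Fin using (Fin; zero; suc; toℕ; fromℕ; inject₁; punchOut; _↑ˡ_)
open import Data.Fin.Patterns
import Data.Fin.Properties as Fin
open import Data.Fin.Properties using (_≟_; all?; any?)
open import Data.Fin.Relation.Unary.Top using (view; ‵fromℕ; ‵inject₁)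
open import Data.Fin.Subset using (Subset; _∈_; _∩_; ∣_∣; Empty)
open import Data.Fin.Subset.Properties
  using (_∈?_; nonempty?; x∈p∩q⁺; x∈p∩q⁻; ∩-comm; ∩-idem; x∈p⇒∣p-x∣<∣p∣; x∈p∧x≢y⇒x∈p-y; Empty-unique; ∣⊥∣≡0)
import Data.Integer as ℤ
open import Data.Integer using (ℤ; +_; +0)
import Data.Integer.Properties as ℤP
import Data.Integer.Tactic.RingSolver as ℤSolver
open import Data.List as List using (List; []; _∷_; _++_; foldr; map; concat)
open import Data.List.Membership.Propositional using () renaming (_∈_ to _∈ˡ_)
open import Data.List.Membership.Propositional.Properties using (∈-tabulate⁺; ∈-tabulate⁻; ∈-concat⁺′; ∈-allFin)
open import Data.List.Membership.Propositional.Properties.WithK using (unique∧set⇒bag)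
open import Data.List.Properties using (foldr-++; length-++; length-map; length-tabulate; map-tabulate; tabulate-cong)
open import Data.List.Relation.Binary.BagAndSetEquality using (∼bag⇒↭)
open import Data.List.Relation.Binary.Permutation.Propositional.Properties using (↭-length)
open import Data.List.Relation.Unary.All as All using (All; []; _∷_)
open import Data.List.Relation.Unary.All.Properties using () renaming (tabulate⁺ to all-tabulate⁺; map⁺ to all-map⁺)
open import Data.List.Relation.Unary.AllPairs as AllPairs using (AllPairs; []; _∷_)
open import Data.List.Relation.Unary.AllPairs.Properties using ()
  renaming (tabulate⁺ to allPairs-tabulate⁺; map⁺ to allPairs-map⁺)
open import Data.List.Relation.Unary.Unique.Propositional using (Unique)
import Data.List.Relation.Unary.Unique.Propositional.Properties as Unique
open import Data.Maybe using (just; nothing)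
open import Data.Nat as ℕ using (ℕ; zero; suc; z≤n; s≤s; NonZero)
open import Data.Nat.Coprimality using (Coprime; coprime-/gcd; coprime-divisor)
open import Data.Nat.Divisibility using (divides; ∣-refl)
open import Data.Nat.DivMod using (_/_; _%_; m/n*n≡m; m<n⇒m%n≡m; n%n≡0; m%n<n)
open import Data.Nat.GCD using (gcd; gcd[m,n]∣m; gcd[m,n]∣n; gcd[m,n]≢0)
open import Data.Nat.ListAction using () renaming (sum to sumˡ)
import Data.Nat.Properties as ℕP
import Data.Nat.Tactic.RingSolver as ℕSolver
open import Data.Product using (Σ; _×_; _,_; proj₁; proj₂; uncurry; ∃-syntax; ∃₂)
open import Data.Product.Properties using (,-injectiveˡ; ,-injectiveʳ-UIP)
open import Data.Sum as Sum⊎ using (_⊎_; inj₁; inj₂; [_,_]′)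
open import Data.Sum.Properties using () renaming (≡-dec to ⊎-≡-dec)
open import Data.Unit using (⊤; tt)
open import Data.Vec as Vec using ([]; _∷_; lookup; tabulate; here; there)
open import Data.Vec.Functional using (Vector; head; tail)
open import Data.Vec.Properties using (lookup∘tabulate; tabulate∘lookup; lookup-zipWith; []=⇒lookup; lookup⇒[]=)
import Data.Vec.Properties as Vec
open import Function using (_∘_; case_of_; _↔_; mk↔ₛ′; mk⇔)
open import Function.Definitions using (Injective)
open import Level using (0ℓ)
open import Relation.Binary.PropositionalEquality
open import Relation.Nullary using (Dec; yes; no; ¬_; contradiction)
open import Relation.Nullary.Decidable using (True; toWitness; _→-dec_; _⊎-dec_; _×-dec_; ¬?)
import Tactic.RingSolver.Core.AlmostCommutativeRing as ACR
import Tactic.RingSolver.NonReflective as NonReflective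

-- The parity matters for the following reason. For odd `m` the same computation makes x^(-h) ∏ (x^ℓ
-- - 1), with v = 2h + 1, an integer multiple of x - 1 instead of x + 1. Since x⁻¹ (x - 1)² = n - 2,
-- the relation then reads c² = (n - 2)² a², which is no contradiction; for even `m` the identity
-- x⁻¹ (x + 1)² = n + 2 leaves the factor (n - 2)(n + 2), which is not a square. The method is tied
-- to n ≥ 3. At n = 2 the factor n - 2 vanishes and x = 1 is a double root, and at n = 1 the element
-- x is a root of unity, so that the product over the cycles may vanish; both cases are therefore
-- settled by direct incidence arguments. The incidence rows and the cycle vectors belong to
-- different diagonal forms, and neither family is expressed through the other. They are linked only
-- by their common matrix of scalar products `G`.

-- The ring ℤ[x]/(x² − νx + 1): the pair ⟦ a , b ⟧ is a + bx.
data Quadratic : Set where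
  ⟦_,_⟧ : (a b : ℤ) → Quadratic

-- Arithmetic of the quadratic ring.

private module Identities where
  open import Data.Integer
  assoc₁ : ∀ ν a b c d e f → (a * c - b * d) * e - (a * d + b * c + b * d * ν) * f ≡ a * (c * e - d * f) - b * (c * f + d * e + d * f * ν)
  assoc₁ = ℤSolver.solve-∀
  assoc₂ : ∀ ν a b c d e f → (a * c - b * d) * f + (a * d + b * c + b * d * ν) * e + (a * d + b * c + b * d * ν) * f * ν ≡ a * (c * f + d * e + d * f * ν) + b * (c * e - d * f) + b * (c * f + d * e + d * f * ν) * ν
  assoc₂ = ℤSolver.solve-∀
  idˡ₁ : ∀ a b → + 1 * a - + 0 * b ≡ a
  idˡ₁ = ℤSolver.solve-∀
  idˡ₂ : ∀ ν a b → + 1 * b + + 0 * a + + 0 * b * ν ≡ b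
  idˡ₂ = ℤSolver.solve-∀
  distribˡ₁ : ∀ a b c d e f → a * (c + e) - b * (d + f) ≡ (a * c - b * d) + (a * e - b * f)
  distribˡ₁ = ℤSolver.solve-∀
  distribˡ₂ : ∀ ν a b c d e f → a * (d + f) + b * (c + e) + b * (d + f) * ν ≡ (a * d + b * c + b * d * ν) + (a * f + b * e + b * f * ν)
  distribˡ₂ = ℤSolver.solve-∀
  comm₁ : ∀ a b c d → a * c - b * d ≡ c * a - d * b
  comm₁ = ℤSolver.solve-∀
  comm₂ : ∀ ν a b c d → a * d + b * c + b * d * ν ≡ c * b + d * a + d * b * ν
  comm₂ = ℤSolver.solve-∀

module QuadraticRing (ν : ℤ) where
  infixl 6 _+_
  infixl 7 _*_
  infix 8 -_

  _+_ _*_ : Quadratic → Quadratic → Quadratic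
  ⟦ a , b ⟧ + ⟦ c , d ⟧ = ⟦ a ℤ.+ c , b ℤ.+ d ⟧
  ⟦ a , b ⟧ * ⟦ c , d ⟧ = ⟦ a ℤ.* c ℤ.- b ℤ.* d , a ℤ.* d ℤ.+ b ℤ.* c ℤ.+ b ℤ.* d ℤ.* ν ⟧

  -_ : Quadratic → Quadratic
  - ⟦ a , b ⟧ = ⟦ ℤ.- a , ℤ.- b ⟧

  0# 1# : Quadratic
  0# = ⟦ + 0 , + 0 ⟧
  1# = ⟦ + 1 , + 0 ⟧

  isCommutativeRing : IsCommutativeRing _≡_ _+_ _*_ -_ 0# 1#
  isCommutativeRing = record
    { isRing = record
      { +-isAbelianGroup = record
        { isGroup = record
          { isMonoid = record
            { isSemigroup = record
              { isMagma = isMagma _+_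
              ; assoc = λ { ⟦ a , b ⟧ ⟦ c , d ⟧ ⟦ e , f ⟧ → cong₂ ⟦_,_⟧ (ℤP.+-assoc a c e) (ℤP.+-assoc b d f) }
              }
            ; identity = (λ { ⟦ a , b ⟧ → cong₂ ⟦_,_⟧ (ℤP.+-identityˡ a) (ℤP.+-identityˡ b) })
                       , (λ { ⟦ a , b ⟧ → cong₂ ⟦_,_⟧ (ℤP.+-identityʳ a) (ℤP.+-identityʳ b) })
            }
          ; inverse = (λ { ⟦ a , b ⟧ → cong₂ ⟦_,_⟧ (ℤP.+-inverseˡ a) (ℤP.+-inverseˡ b) })
                    , (λ { ⟦ a , b ⟧ → cong₂ ⟦_,_⟧ (ℤP.+-inverseʳ a) (ℤP.+-inverseʳ b) })
          ; ⁻¹-cong = cong -_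
          }
        ; comm = λ { ⟦ a , b ⟧ ⟦ c , d ⟧ → cong₂ ⟦_,_⟧ (ℤP.+-comm a c) (ℤP.+-comm b d) }
        }
      ; *-cong = cong₂ _*_
      ; *-assoc = λ { ⟦ a , b ⟧ ⟦ c , d ⟧ ⟦ e , f ⟧ → cong₂ ⟦_,_⟧ (assoc₁ ν a b c d e f) (assoc₂ ν a b c d e f) }
      ; *-identity = comm∧idˡ⇒id *-comm (λ { ⟦ a , b ⟧ → cong₂ ⟦_,_⟧ (idˡ₁ a b) (idˡ₂ ν a b) })
      ; distrib = distribˡ , comm∧distrˡ⇒distrʳ {_∙_ = _*_} {_◦_ = _+_} *-comm distribˡ
      }
    ; *-comm = *-comm
    }
    where
    open Identities
    distribˡ : ∀ u w z → u * (w + z) ≡ u * w + u * z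
    distribˡ ⟦ a , b ⟧ ⟦ c , d ⟧ ⟦ e , f ⟧ = cong₂ ⟦_,_⟧ (distribˡ₁ a b c d e f) (distribˡ₂ ν a b c d e f)

    *-comm : ∀ u w → u * w ≡ w * u
    *-comm ⟦ a , b ⟧ ⟦ c , d ⟧ = cong₂ ⟦_,_⟧ (comm₁ a b c d) (comm₂ ν a b c d)

  commutativeRing : CommutativeRing 0ℓ 0ℓ
  commutativeRing = record { isCommutativeRing = isCommutativeRing }

  almostCommutativeRing : ACR.AlmostCommutativeRing 0ℓ 0ℓ
  almostCommutativeRing = ACR.fromCommutativeRing commutativeRing λ where
    -- Integer constants evaluate to closed pairs even while `ν` is a variable, because 0 · ν
    -- reduces to 0; the solver thus sees when coefficients cancel.
    ⟦ +0 , +0 ⟧ → just refl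
    _           → nothing

  module K = CommutativeRing commutativeRing
  open K public using (_-_)
  open NonReflective almostCommutativeRing public using (solve; _⊕_; _⊗_; ⊝_; Κ)

-- Paths of a map, and the exterior algebra with its induced form.

module _ {I : Set} (σ : I → I) where

  -- The endpoint `z` follows the last entry and is not itself listed, so a cycle is a path that
  -- ends where it starts.
  Path : I → List I → I → Set
  Path i []       z = σ i ≡ z
  Path i (j ∷ js) z = σ i ≡ j × Path j js z

  Cycle : List I → Set
  Cycle (i ∷ j ∷ js) = Path i (j ∷ js) i
  Cycle _            = ⊥

module Exterior (ν : ℤ) where
  open QuadraticRing ν
  open Sum K.semiring using (sum)
  open Exp K.semiring using (_^_)
  open ≡-Reasoning

  infixl 6 _⊞_
  infixr 7 _·_ _∧_

  -- The exterior algebra of Kⁿ: (a , b) stands for a + e₀ ∧ b, where a and b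
  -- do not involve the first basis vector e₀.
  Λ : ℕ → Set
  Λ zero    = Quadratic
  Λ (suc n) = Λ n × Λ n

  0Λ 1Λ : ∀ n → Λ n
  0Λ zero    = 0#
  0Λ (suc n) = 0Λ n , 0Λ n
  1Λ zero    = 1#
  1Λ (suc n) = 1Λ n , 0Λ n

  _⊞_ : ∀ {n} → Λ n → Λ n → Λ n
  _⊞_ {zero}  a       b       = a + b
  _⊞_ {suc n} (a , b) (c , d) = a ⊞ c , b ⊞ d

  _·_ : ∀ {n} → Quadratic → Λ n → Λ n
  _·_ {zero}  α a       = α * a
  _·_ {suc n} α (a , b) = α · a , α · b

  ⊟_ : ∀ {n} → Λ n → Λ n
  ⊟ x = - 1# · x

  -- Left multiplication by the vector v₀ e₀ + v′; the sign comes from moving v′ past e₀.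
  _∧_ : ∀ {n} → Vector Quadratic n → Λ n → Λ n
  _∧_ {zero}  v x       = 0#
  _∧_ {suc n} v (a , b) = tail v ∧ a , head v · a ⊞ ⊟ (tail v ∧ b)

  -- The contraction with u with respect to the quadratic form Σ D i (X i)².
  ι : ∀ {n} → Vector Quadratic n → Vector Quadratic n → Λ n → Λ n
  ι {zero}  D u x       = 0#
  ι {suc n} D u (a , b) = ι (tail D) (tail u) a ⊞ (head D * head u) · b , ⊟ ι (tail D) (tail u) b

  dot : ∀ {n} → Vector Quadratic n → Vector Quadratic n → Vector Quadratic n → Quadratic
  dot D v w = sum λ i → D i * v i * w i

  -- The induced form: the monomials in the basis vectors are orthogonal, and the norm of a monomial
  -- is the product of the entries of `D` at its factors.
  form : ∀ {n} → Vector Quadratic n → Λ n → Λ n → Quadratic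
  form {zero}  D x       y       = x * y
  form {suc n} D (a , b) (c , d) = form (tail D) a c + head D * form (tail D) b d

  ⊟-congʳ : ∀ {n} {x y z : Λ n} → y ≡ z → x ⊞ ⊟ y ≡ x ⊞ ⊟ z
  ⊟-congʳ refl = refl

  ⊞-congʳ : ∀ {n} {x y z : Λ n} → y ≡ z → x ⊞ y ≡ x ⊞ z
  ⊞-congʳ refl = refl

  ⊞-congˡ : ∀ {n} {x y z : Λ n} → x ≡ y → x ⊞ z ≡ y ⊞ z
  ⊞-congˡ refl = refl

  ·-distribˡ-⊞ : ∀ {n} α (x y : Λ n) → α · (x ⊞ y) ≡ α · x ⊞ α · y
  ·-distribˡ-⊞ {zero}  = solve 3 (λ α x y → α ⊗ (x ⊕ y) , α ⊗ x ⊕ α ⊗ y) refl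
  ·-distribˡ-⊞ {suc n} α (a , b) (c , d) = cong₂ _,_ (·-distribˡ-⊞ α a c) (·-distribˡ-⊞ α b d)

  ·-comm : ∀ {n} α β (x : Λ n) → α · β · x ≡ β · α · x
  ·-comm {zero}  = solve 3 (λ α β x → α ⊗ (β ⊗ x) , β ⊗ (α ⊗ x)) refl
  ·-comm {suc n} α β (a , b) = cong₂ _,_ (·-comm α β a) (·-comm α β b)

  ·-assoc : ∀ {n} α β (x : Λ n) → (α * β) · x ≡ α · β · x
  ·-assoc {zero}  = solve 3 (λ α β x → (α ⊗ β) ⊗ x , α ⊗ (β ⊗ x)) refl
  ·-assoc {suc n} α β (a , b) = cong₂ _,_ (·-assoc α β a) (·-assoc α β b)

  ·-identity : ∀ {n} (x : Λ n) → 1# · x ≡ x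
  ·-identity {zero}  = K.*-identityˡ
  ·-identity {suc n} (a , b) = cong₂ _,_ (·-identity a) (·-identity b)

  ·-distrib-minus : ∀ {n} α β (x : Λ n) → (α - β) · x ≡ α · x ⊞ ⊟ (β · x)
  ·-distrib-minus {zero}  = solve 3 (λ α β x → (α ⊕ ⊝ β) ⊗ x , α ⊗ x ⊕ ⊝ Κ 1# ⊗ (β ⊗ x)) refl
  ·-distrib-minus {suc n} α β (a , b) = cong₂ _,_ (·-distrib-minus α β a) (·-distrib-minus α β b)

  ·-zeroʳ : ∀ {n} α → α · 0Λ n ≡ 0Λ n
  ·-zeroʳ {zero}  = K.zeroʳ
  ·-zeroʳ {suc n} α = cong₂ _,_ (·-zeroʳ α) (·-zeroʳ α)

  ⊞-identityˡ : ∀ {n} (x : Λ n) → 0Λ n ⊞ x ≡ x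
  ⊞-identityˡ {zero}  = K.+-identityˡ
  ⊞-identityˡ {suc n} (a , b) = cong₂ _,_ (⊞-identityˡ a) (⊞-identityˡ b)

  ⊞-identityʳ : ∀ {n} (x : Λ n) → x ⊞ 0Λ n ≡ x
  ⊞-identityʳ {zero}  = K.+-identityʳ
  ⊞-identityʳ {suc n} (a , b) = cong₂ _,_ (⊞-identityʳ a) (⊞-identityʳ b)

  ⊞-inverseʳ : ∀ {n} (x : Λ n) → x ⊞ ⊟ x ≡ 0Λ n
  ⊞-inverseʳ {zero}  = solve 1 (λ x → x ⊕ ⊝ Κ 1# ⊗ x , Κ 0#) refl
  ⊞-inverseʳ {suc n} (a , b) = cong₂ _,_ (⊞-inverseʳ a) (⊞-inverseʳ b)

  ∧-distribˡ-⊞ : ∀ {n} (v : Vector Quadratic n) x y → v ∧ (x ⊞ y) ≡ v ∧ x ⊞ v ∧ y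
  ∧-distribˡ-⊞ {zero}  v x y = refl
  ∧-distribˡ-⊞ {suc n} v (a , b) (c , d) = cong₂ _,_ (∧-distribˡ-⊞ _ a c) (begin
    head v · (a ⊞ c) ⊞ ⊟ (tail v ∧ (b ⊞ d))           ≡⟨ ⊟-congʳ (∧-distribˡ-⊞ _ b d) ⟩
    head v · (a ⊞ c) ⊞ ⊟ (tail v ∧ b ⊞ tail v ∧ d)    ≡⟨ identity (head v) a c (tail v ∧ b) (tail v ∧ d) ⟩
    _                                                 ∎)
    where
    -- An identity between linear expressions in Λ n holds coefficient by coefficient, so recursion
    -- on n reduces it to the ring.
    identity : ∀ {n} α (a c b d : Λ n) → α · (a ⊞ c) ⊞ ⊟ (b ⊞ d) ≡ α · a ⊞ ⊟ b ⊞ (α · c ⊞ ⊟ d)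
    identity {zero}  = solve 5 (λ α a c b d → α ⊗ (a ⊕ c) ⊕ ⊝ Κ 1# ⊗ (b ⊕ d) , α ⊗ a ⊕ ⊝ Κ 1# ⊗ b ⊕ (α ⊗ c ⊕ ⊝ Κ 1# ⊗ d)) refl
    identity {suc n} α (a , a′) (c , c′) (b , b′) (d , d′) = cong₂ _,_ (identity α a c b d) (identity α a′ c′ b′ d′)

  ∧-· : ∀ {n} (v : Vector Quadratic n) α x → v ∧ (α · x) ≡ α · v ∧ x
  ∧-· {zero}  v α x = sym (K.zeroʳ α)
  ∧-· {suc n} v α (a , b) = cong₂ _,_ (∧-· _ α a) (begin
    head v · α · a ⊞ ⊟ (tail v ∧ (α · b))  ≡⟨ ⊟-congʳ (∧-· _ α b) ⟩
    head v · α · a ⊞ ⊟ (α · tail v ∧ b)    ≡⟨ cong₂ _⊞_ (·-comm _ α a) (·-comm _ α _) ⟩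
    α · head v · a ⊞ α · ⊟ (tail v ∧ b)    ≡⟨ ·-distribˡ-⊞ α _ _ ⟨
    _                                      ∎)

  ∧-zeroʳ : ∀ {n} (v : Vector Quadratic n) → v ∧ 0Λ n ≡ 0Λ n
  ∧-zeroʳ {zero}  v = refl
  ∧-zeroʳ {suc n} v = cong₂ _,_ (∧-zeroʳ _)
    (trans (cong₂ (λ x y → x ⊞ ⊟ y) (·-zeroʳ _) (∧-zeroʳ _)) (⊞-inverseʳ _))

  ∧-self : ∀ {n} (v : Vector Quadratic n) x → v ∧ v ∧ x ≡ 0Λ n
  ∧-self {zero}  v x = refl
  ∧-self {suc n} v (a , b) = cong₂ _,_ (∧-self _ a) (begin
    head v · A ⊞ ⊟ (tail v ∧ (head v · a ⊞ ⊟ B))           ≡⟨ ⊟-congʳ (∧-distribˡ-⊞ _ _ _) ⟩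
    head v · A ⊞ ⊟ (tail v ∧ (head v · a) ⊞ tail v ∧ ⊟ B)  ≡⟨ ⊟-congʳ (cong₂ _⊞_ (∧-· _ _ _) (∧-· _ _ _)) ⟩
    head v · A ⊞ ⊟ (head v · A ⊞ ⊟ (tail v ∧ B))           ≡⟨ ⊟-congʳ (⊟-congʳ (∧-self _ b)) ⟩
    head v · A ⊞ ⊟ (head v · A ⊞ ⊟ 0Λ n)                   ≡⟨ ⊟-congʳ (⊞-congʳ (·-zeroʳ _)) ⟩
    head v · A ⊞ ⊟ (head v · A ⊞ 0Λ n)                     ≡⟨ ⊟-congʳ (⊞-identityʳ _) ⟩
    head v · A ⊞ ⊟ (head v · A)                            ≡⟨ ⊞-inverseʳ _ ⟩
    0Λ n                                                   ∎)
    where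
    A = tail v ∧ a
    B = tail v ∧ b

  ∧-anticomm : ∀ {n} (v w : Vector Quadratic n) x → v ∧ w ∧ x ≡ ⊟ (w ∧ v ∧ x)
  ∧-anticomm {zero}  v w x = sym (K.zeroʳ (- 1#))
  ∧-anticomm {suc n} v w (a , b) = cong₂ _,_ (∧-anticomm _ _ a) (begin
    head v · (tail w ∧ a) ⊞ ⊟ (tail v ∧ (head w · a ⊞ ⊟ (tail w ∧ b)))
      ≡⟨ ⊟-congʳ (expand v w) ⟩
    head v · (tail w ∧ a) ⊞ ⊟ (head w · (tail v ∧ a) ⊞ ⊟ (tail v ∧ tail w ∧ b))
      ≡⟨ ⊟-congʳ (⊟-congʳ (∧-anticomm _ _ b)) ⟩
    head v · (tail w ∧ a) ⊞ ⊟ (head w · (tail v ∧ a) ⊞ ⊟ ⊟ (tail w ∧ tail v ∧ b))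
      ≡⟨ identity (head v) (head w) _ _ _ ⟩
    ⊟ (head w · (tail v ∧ a) ⊞ ⊟ (head v · (tail w ∧ a) ⊞ ⊟ (tail w ∧ tail v ∧ b)))
      ≡⟨ cong ⊟_ (⊟-congʳ (expand w v)) ⟨
    _ ∎)
    where
    expand : ∀ v w → tail v ∧ (head w · a ⊞ ⊟ (tail w ∧ b)) ≡ head w · (tail v ∧ a) ⊞ ⊟ (tail v ∧ tail w ∧ b)
    expand v w = trans (∧-distribˡ-⊞ (tail v) _ _) (cong₂ _⊞_ (∧-· (tail v) _ _) (∧-· (tail v) _ _))
    identity : ∀ {n} α β (x y z : Λ n) → α · x ⊞ ⊟ (β · y ⊞ ⊟ ⊟ z) ≡ ⊟ (β · y ⊞ ⊟ (α · x ⊞ ⊟ z))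
    identity {zero} = solve 5 (λ α β x y z → α ⊗ x ⊕ ⊝ Κ 1# ⊗ (β ⊗ y ⊕ ⊝ Κ 1# ⊗ (⊝ Κ 1# ⊗ z)) , ⊝ Κ 1# ⊗ (β ⊗ y ⊕ ⊝ Κ 1# ⊗ (α ⊗ x ⊕ ⊝ Κ 1# ⊗ z))) refl
    identity {suc n} α β (x , x′) (y , y′) (z , z′) = cong₂ _,_ (identity α β x y z) (identity α β x′ y′ z′)

  ∧-linearˡ : ∀ {n} α (v w : Vector Quadratic n) x → (λ i → α * v i - w i) ∧ x ≡ α · v ∧ x ⊞ ⊟ (w ∧ x)
  ∧-linearˡ {zero}  α v w x = sym (solve 1 (λ α → α ⊗ Κ 0# ⊕ ⊝ Κ 1# ⊗ Κ 0# , Κ 0#) refl α)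
  ∧-linearˡ {suc n} α v w (a , b) = cong₂ _,_ (∧-linearˡ α _ _ a) (begin
    (α * head v - head w) · a ⊞ ⊟ ((λ i → α * tail v i - tail w i) ∧ b)  ≡⟨ ⊟-congʳ (∧-linearˡ α (tail v) (tail w) b) ⟩
    (α * head v - head w) · a ⊞ ⊟ (α · tail v ∧ b ⊞ ⊟ (tail w ∧ b))      ≡⟨ identity α (head v) (head w) a _ _ ⟩
    _ ∎)
    where
    identity : ∀ {n} α β γ (a x y : Λ n) → (α * β - γ) · a ⊞ ⊟ (α · x ⊞ ⊟ y) ≡ α · (β · a ⊞ ⊟ x) ⊞ ⊟ (γ · a ⊞ ⊟ y)
    identity {zero} = solve 6 (λ α β γ a x y → (α ⊗ β ⊕ ⊝ γ) ⊗ a ⊕ ⊝ Κ 1# ⊗ (α ⊗ x ⊕ ⊝ Κ 1# ⊗ y) , α ⊗ (β ⊗ a ⊕ ⊝ Κ 1# ⊗ x) ⊕ ⊝ Κ 1# ⊗ (γ ⊗ a ⊕ ⊝ Κ 1# ⊗ y)) refl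
    identity {suc n} α β γ (a , a′) (x , x′) (y , y′) = cong₂ _,_ (identity α β γ a x y) (identity α β γ a′ x′ y′)

  ι-distrib-⊞ : ∀ {n} (D u : Vector Quadratic n) x y → ι D u (x ⊞ y) ≡ ι D u x ⊞ ι D u y
  ι-distrib-⊞ {zero}  D u x y = refl
  ι-distrib-⊞ {suc n} D u (a , b) (c , d) = cong₂ _,_
    (trans (⊞-congˡ (ι-distrib-⊞ _ _ a c)) (identity (head D * head u) _ b _ d))
    (trans (cong ⊟_ (ι-distrib-⊞ _ _ b d)) (·-distribˡ-⊞ _ _ _))
    where
    identity : ∀ {n} α (a b c d : Λ n) → a ⊞ c ⊞ α · (b ⊞ d) ≡ a ⊞ α · b ⊞ (c ⊞ α · d)
    identity {zero} = solve 5 (λ α a b c d → a ⊕ c ⊕ α ⊗ (b ⊕ d) , a ⊕ α ⊗ b ⊕ (c ⊕ α ⊗ d)) refl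
    identity {suc n} α (a , a′) (b , b′) (c , c′) (d , d′) = cong₂ _,_ (identity α a b c d) (identity α a′ b′ c′ d′)

  ι-· : ∀ {n} (D u : Vector Quadratic n) α x → ι D u (α · x) ≡ α · ι D u x
  ι-· {zero}  D u α x = sym (K.zeroʳ α)
  ι-· {suc n} D u α (a , b) = cong₂ _,_
    (trans (cong₂ _⊞_ (ι-· _ _ α a) (·-comm _ α b)) (sym (·-distribˡ-⊞ α _ _)))
    (trans (cong ⊟_ (ι-· _ _ α b)) (·-comm _ α _))

  ι-1Λ : ∀ {n} (D u : Vector Quadratic n) → ι D u (1Λ n) ≡ 0Λ n
  ι-0Λ : ∀ {n} (D u : Vector Quadratic n) → ι D u (0Λ n) ≡ 0Λ n
  ι-0Λ {zero}  D u = refl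
  ι-0Λ {suc n} D u = cong₂ _,_ (trans (cong₂ _⊞_ (ι-0Λ _ _) (·-zeroʳ _)) (⊞-identityˡ _)) (trans (cong ⊟_ (ι-0Λ _ _)) (·-zeroʳ _))
  ι-1Λ {zero}  D u = refl
  ι-1Λ {suc n} D u = cong₂ _,_ (trans (cong₂ _⊞_ (ι-1Λ _ _) (·-zeroʳ _)) (⊞-identityˡ _)) (trans (cong ⊟_ (ι-0Λ _ _)) (·-zeroʳ _))

  -- Contraction is an antiderivation. Both the Laplace expansion and the evaluation on orthogonal
  -- vectors follow from this rule.
  ι-∧ : ∀ {n} (D u w : Vector Quadratic n) x → ι D u (w ∧ x) ≡ dot D u w · x ⊞ ⊟ (w ∧ ι D u x)
  ι-∧ {zero}  D u w x = sym (solve 1 (λ x → Κ 0# ⊗ x ⊕ ⊝ Κ 1# ⊗ Κ 0# , Κ 0#) refl x)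
  ι-∧ {suc n} D u w (a , b) = cong₂ _,_
    (begin
      ι D′ u′ (w′ ∧ a) ⊞ (d * u₀) · (w₀ · a ⊞ ⊟ (w′ ∧ b))
        ≡⟨ ⊞-congˡ (ι-∧ D′ u′ w′ a) ⟩
      δ · a ⊞ ⊟ (w′ ∧ ι D′ u′ a) ⊞ (d * u₀) · (w₀ · a ⊞ ⊟ (w′ ∧ b))
        ≡⟨ identity₁ δ (d * u₀) w₀ a (w′ ∧ ι D′ u′ a) (w′ ∧ b) ⟩
      (d * u₀ * w₀ + δ) · a ⊞ ⊟ (w′ ∧ ι D′ u′ a ⊞ (d * u₀) · w′ ∧ b)
        ≡⟨ ⊟-congʳ (⊞-congʳ (∧-· w′ _ b)) ⟨
      (d * u₀ * w₀ + δ) · a ⊞ ⊟ (w′ ∧ ι D′ u′ a ⊞ w′ ∧ ((d * u₀) · b))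
        ≡⟨ ⊟-congʳ (∧-distribˡ-⊞ w′ _ _) ⟨
      _ ∎)
    (begin
      ⊟ ι D′ u′ (w₀ · a ⊞ ⊟ (w′ ∧ b))
        ≡⟨ cong ⊟_ (ι-distrib-⊞ D′ u′ _ _) ⟩
      ⊟ (ι D′ u′ (w₀ · a) ⊞ ι D′ u′ (⊟ (w′ ∧ b)))
        ≡⟨ cong₂ (λ y z → ⊟ (y ⊞ z)) (ι-· D′ u′ _ _) (trans (ι-· D′ u′ _ _) (cong ⊟_ (ι-∧ D′ u′ w′ b))) ⟩
      ⊟ (w₀ · ι D′ u′ a ⊞ ⊟ (δ · b ⊞ ⊟ (w′ ∧ ι D′ u′ b)))
        ≡⟨ identity₂ w₀ δ (d * u₀) (ι D′ u′ a) b (w′ ∧ ι D′ u′ b) ⟩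
      (d * u₀ * w₀ + δ) · b ⊞ ⊟ (w₀ · (ι D′ u′ a ⊞ (d * u₀) · b) ⊞ ⊟ ⊟ (w′ ∧ ι D′ u′ b))
        ≡⟨ ⊟-congʳ (⊟-congʳ (∧-· w′ _ _)) ⟨
      _ ∎)
    where
    d  = head D
    D′ = tail D
    u₀ = head u
    u′ = tail u
    w₀ = head w
    w′ = tail w
    δ  = dot D′ u′ w′
    identity₁ : ∀ {n} α β γ (a x y : Λ n) → α · a ⊞ ⊟ x ⊞ β · (γ · a ⊞ ⊟ y) ≡ (β * γ + α) · a ⊞ ⊟ (x ⊞ β · y)
    identity₁ {zero} = solve 6 (λ α β γ a x y → α ⊗ a ⊕ ⊝ Κ 1# ⊗ x ⊕ β ⊗ (γ ⊗ a ⊕ ⊝ Κ 1# ⊗ y) , (β ⊗ γ ⊕ α) ⊗ a ⊕ ⊝ Κ 1# ⊗ (x ⊕ β ⊗ y)) refl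
    identity₁ {suc n} α β γ (a , a′) (x , x′) (y , y′) = cong₂ _,_ (identity₁ α β γ a x y) (identity₁ α β γ a′ x′ y′)
    identity₂ : ∀ {n} α β γ (x b y : Λ n) → ⊟ (α · x ⊞ ⊟ (β · b ⊞ ⊟ y)) ≡ (γ * α + β) · b ⊞ ⊟ (α · (x ⊞ γ · b) ⊞ ⊟ ⊟ y)
    identity₂ {zero} = solve 6 (λ α β γ x b y → ⊝ Κ 1# ⊗ (α ⊗ x ⊕ ⊝ Κ 1# ⊗ (β ⊗ b ⊕ ⊝ Κ 1# ⊗ y)) , (γ ⊗ α ⊕ β) ⊗ b ⊕ ⊝ Κ 1# ⊗ (α ⊗ (x ⊕ γ ⊗ b) ⊕ ⊝ Κ 1# ⊗ (⊝ Κ 1# ⊗ y))) refl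
    identity₂ {suc n} α β γ (a , a′) (x , x′) (y , y′) = cong₂ _,_ (identity₂ α β γ a x y) (identity₂ α β γ a′ x′ y′)

  form-⊞ˡ : ∀ {n} (D : Vector Quadratic n) x y z → form D (x ⊞ y) z ≡ form D x z + form D y z
  form-⊞ˡ {zero}  D = solve 3 (λ x y z → (x ⊕ y) ⊗ z , x ⊗ z ⊕ y ⊗ z) refl
  form-⊞ˡ {suc n} D (a , b) (c , d) (e , f) = trans
    (cong₂ (λ y z → y + head D * z) (form-⊞ˡ (tail D) a c e) (form-⊞ˡ (tail D) b d f))
    (solve 5 (λ δ p q r s → p ⊕ q ⊕ δ ⊗ (r ⊕ s) , p ⊕ δ ⊗ r ⊕ (q ⊕ δ ⊗ s)) refl (head D) _ _ _ _)

  form-·ˡ : ∀ {n} (D : Vector Quadratic n) α x z → form D (α · x) z ≡ α * form D x z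
  form-·ˡ {zero}  D = K.*-assoc
  form-·ˡ {suc n} D α (a , b) (e , f) = trans
    (cong₂ (λ y z → y + head D * z) (form-·ˡ (tail D) α a e) (form-·ˡ (tail D) α b f))
    (solve 4 (λ δ α p q → α ⊗ p ⊕ δ ⊗ (α ⊗ q) , α ⊗ (p ⊕ δ ⊗ q)) refl (head D) α _ _)

  form-comm : ∀ {n} (D : Vector Quadratic n) x y → form D x y ≡ form D y x
  form-comm {zero}  D = K.*-comm
  form-comm {suc n} D (a , b) (c , d) = cong₂ (λ y z → y + head D * z) (form-comm (tail D) a c) (form-comm (tail D) b d)

  form-⊞ʳ : ∀ {n} (D : Vector Quadratic n) x y z → form D z (x ⊞ y) ≡ form D z x + form D z y
  form-⊞ʳ D x y z = trans (form-comm D z _) (trans (form-⊞ˡ D x y z) (cong₂ _+_ (form-comm D x z) (form-comm D y z)))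

  form-·ʳ : ∀ {n} (D : Vector Quadratic n) α x z → form D z (α · x) ≡ α * form D z x
  form-·ʳ D α x z = trans (form-comm D z _) (trans (form-·ˡ D α x z) (cong (α *_) (form-comm D x z)))

  form-zeroʳ : ∀ {n} (D : Vector Quadratic n) z → form D z (0Λ n) ≡ 0#
  form-zeroʳ {zero}  D z = K.zeroʳ z
  form-zeroʳ {suc n} D (a , b) = trans (cong₂ (λ y z → y + head D * z) (form-zeroʳ (tail D) a) (form-zeroʳ (tail D) b)) (trans (K.+-identityˡ _) (K.zeroʳ _))

  -- The weights in `ι` are those that make it adjoint to multiplication; this moves one vector at a
  -- time from the left wedge to a contraction of the right one.
  ∧-ι-adjoint : ∀ {n} (D w : Vector Quadratic n) x y → form D (w ∧ x) y ≡ form D x (ι D w y)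
  ∧-ι-adjoint {zero}  D w x y = trans (K.zeroˡ y) (sym (K.zeroʳ x))
  ∧-ι-adjoint {suc n} D w (a , b) (c , e) = begin
    form D′ (w′ ∧ a) c + d * form D′ (w₀ · a ⊞ ⊟ (w′ ∧ b)) e
      ≡⟨ cong₂ (λ y z → y + d * z) (∧-ι-adjoint D′ w′ a c)
           (trans (form-⊞ˡ D′ _ _ e) (cong₂ _+_ (form-·ˡ D′ _ a e) (trans (form-·ˡ D′ _ _ e) (cong (- 1# *_) (∧-ι-adjoint D′ w′ b e))))) ⟩
    p + d * (w₀ * q + - 1# * r)
      ≡⟨ solve 5 (λ p d w q r → p ⊕ d ⊗ (w ⊗ q ⊕ ⊝ Κ 1# ⊗ r) , p ⊕ d ⊗ w ⊗ q ⊕ d ⊗ (⊝ Κ 1# ⊗ r)) refl p d w₀ q r ⟩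
    p + d * w₀ * q + d * (- 1# * r)
      ≡⟨ cong₂ (λ y z → y + d * z) (trans (form-⊞ʳ D′ _ _ a) (cong (λ s → p + s) (form-·ʳ D′ _ e a))) (form-·ʳ D′ _ _ b) ⟨
    _ ∎
    where
    d  = head D
    D′ = tail D
    w₀ = head w
    w′ = tail w
    p = form D′ a (ι D′ w′ c)
    q = form D′ a e
    r = form D′ b (ι D′ w′ e)

  private variable
    n : ℕ
    I : Set

  -- The final factor `x` is kept arbitrary so that a concatenation of cycles can be treated one
  -- cycle at a time.
  wedge : (I → Vector Quadratic n) → List I → Λ n → Λ n
  wedge w is x = foldr (λ i y → w i ∧ y) x is

  wedge-++ : ∀ (w : I → Vector Quadratic n) is js x → wedge w (is ++ js) x ≡ wedge w is (wedge w js x)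
  wedge-++ w is js x = foldr-++ _ x is js

  wedge-· : ∀ (w : I → Vector Quadratic n) is α x → wedge w is (α · x) ≡ α · wedge w is x
  wedge-· w []       α x = refl
  wedge-· w (i ∷ is) α x = trans (cong (w i ∧_) (wedge-· w is α x)) (∧-· (w i) α _)

  linearCombination : (I → Vector Quadratic n) → List (Quadratic × List I) → Λ n
  linearCombination w []             = 0Λ _
  linearCombination w ((α , is) ∷ l) = α · wedge w is (1Λ _) ⊞ linearCombination w l

  -- Both the contraction of a wedge and, below, the form on wedges are Laplace
  -- expansions, so that they are functions of the scalar products alone.
  contraction : (I → Quadratic) → List I → List (Quadratic × List I)
  contraction g []       = []
  contraction g (i ∷ is) = (g i , is) ∷ map (λ (α , js) → - 1# * α , i ∷ js) (contraction g is)

  linearCombination-∷ : ∀ (w : I → Vector Quadratic n) i l →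
    linearCombination w (map (λ (α , js) → - 1# * α , i ∷ js) l) ≡ ⊟ (w i ∧ linearCombination w l)
  linearCombination-∷ w i [] = sym (trans (cong ⊟_ (∧-zeroʳ (w i))) (·-zeroʳ _))
  linearCombination-∷ {n = n} w i ((α , is) ∷ l) = begin
    (- 1# * α) · w i ∧ X ⊞ _                               ≡⟨ cong₂ _⊞_ (·-assoc (- 1#) α _) (linearCombination-∷ w i l) ⟩
    ⊟ (α · w i ∧ X) ⊞ ⊟ (w i ∧ linearCombination w l)      ≡⟨ ·-distribˡ-⊞ (- 1#) _ _ ⟨
    ⊟ (α · w i ∧ X ⊞ w i ∧ linearCombination w l)          ≡⟨ cong ⊟_ (⊞-congˡ (∧-· (w i) α X)) ⟨
    ⊟ (w i ∧ (α · X) ⊞ w i ∧ linearCombination w l)        ≡⟨ cong ⊟_ (∧-distribˡ-⊞ (w i) _ _) ⟨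
    ⊟ (w i ∧ (α · X ⊞ linearCombination w l))              ∎
    where X = wedge w is (1Λ n)

  ι-wedge : ∀ (D u : Vector Quadratic n) (w : I → Vector Quadratic n) g → (∀ i → dot D u (w i) ≡ g i) → ∀ is →
    ι D u (wedge w is (1Λ n)) ≡ linearCombination w (contraction g is)
  ι-wedge D u w g eq []       = ι-1Λ D u
  ι-wedge D u w g eq (i ∷ is) = trans (ι-∧ D u (w i) _) (cong₂ _⊞_ (cong (_· _) (eq i))
    (trans (cong (λ x → ⊟ (w i ∧ x)) (ι-wedge D u w g eq is)) (sym (linearCombination-∷ w i (contraction g is)))))

  -- For lists of equal length this is the determinant of the matrix of the G j i, expanded along
  -- its first row; for lists of different lengths it is 0.
  gram  : (I → I → Quadratic) → List I → List I → Quadratic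
  gramΣ : (I → I → Quadratic) → List I → List (Quadratic × List I) → Quadratic
  gram G []       []      = 1#
  gram G []       (_ ∷ _) = 0#
  gram G (j ∷ js) is      = gramΣ G js (contraction (G j) is)
  gramΣ G js []             = 0#
  gramΣ G js ((α , is) ∷ l) = α * gram G js is + gramΣ G js l

  form-1Λ : ∀ (D : Vector Quadratic n) → form D (1Λ n) (1Λ n) ≡ 1#
  form-1Λ {zero}  D = K.*-identityˡ 1#
  form-1Λ {suc n} D = trans (cong₂ (λ x y → x + head D * y) (form-1Λ (tail D)) (form-zeroʳ (tail D) _)) (trans (cong (λ s → 1# + s) (K.zeroʳ (head D))) (K.+-identityʳ 1#))

  module _ (D : Vector Quadratic n) (w : I → Vector Quadratic n) (G : I → I → Quadratic)
           (scalarProducts : ∀ i j → dot D (w i) (w j) ≡ G i j) where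

    -- The right-hand side mentions neither `D` nor the vectors, which is what makes families for
    -- two different forms comparable.
    form-wedge : ∀ js is → form D (wedge w js (1Λ n)) (wedge w is (1Λ n)) ≡ gram G js is
    form-linearCombination : ∀ js l → form D (wedge w js (1Λ n)) (linearCombination w l) ≡ gramΣ G js l
    form-wedge []       []       = form-1Λ D
    form-wedge []       (i ∷ is) = begin
      form D (1Λ n) (w i ∧ wedge w is (1Λ n))   ≡⟨ form-comm D _ _ ⟩
      form D (w i ∧ wedge w is (1Λ n)) (1Λ n)   ≡⟨ ∧-ι-adjoint D (w i) _ _ ⟩
      form D _ (ι D (w i) (1Λ n))               ≡⟨ cong (form D _) (ι-1Λ D (w i)) ⟩
      form D _ (0Λ n)                           ≡⟨ form-zeroʳ D _ ⟩
      0#                                        ∎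
    form-wedge (j ∷ js) is = begin
      form D (w j ∧ wedge w js (1Λ n)) (wedge w is (1Λ n))      ≡⟨ ∧-ι-adjoint D (w j) _ _ ⟩
      form D (wedge w js (1Λ n)) (ι D (w j) (wedge w is (1Λ n))) ≡⟨ cong (form D _) (ι-wedge D (w j) w (G j) (scalarProducts j) is) ⟩
      form D (wedge w js (1Λ n)) (linearCombination w (contraction (G j) is))        ≡⟨ form-linearCombination js (contraction (G j) is) ⟩
      _                                                         ∎
    form-linearCombination js []             = form-zeroʳ D _
    form-linearCombination js ((α , is) ∷ l) = trans (form-⊞ʳ D _ _ _)
      (cong₂ _+_ (trans (form-·ʳ D α _ _) (cong (α *_) (form-wedge js is))) (form-linearCombination js l))

    norms : List I → Quadratic
    norms = foldr (λ i x → G i i * x) 1#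

    ι-orthogonal : ∀ j is → All (λ i → G j i ≡ 0#) is → ι D (w j) (wedge w is (1Λ n)) ≡ 0Λ n
    ι-orthogonal j []       []         = ι-1Λ D (w j)
    ι-orthogonal j (i ∷ is) (eq ∷ eqs) = begin
      ι D (w j) (w i ∧ X)                            ≡⟨ ι-∧ D (w j) (w i) X ⟩
      dot D (w j) (w i) · X ⊞ ⊟ (w i ∧ ι D (w j) X)  ≡⟨ cong₂ (λ α y → α · X ⊞ ⊟ (w i ∧ y)) (trans (scalarProducts j i) eq) (ι-orthogonal j is eqs) ⟩
      0# · X ⊞ ⊟ (w i ∧ 0Λ n)                        ≡⟨ cong₂ _⊞_ (·-zeroˡ X) (trans (cong ⊟_ (∧-zeroʳ (w i))) (·-zeroʳ _)) ⟩
      0Λ n ⊞ 0Λ n                                    ≡⟨ ⊞-identityˡ _ ⟩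
      0Λ n                                           ∎
      where
      X = wedge w is (1Λ n)
      ·-zeroˡ : ∀ {n} (x : Λ n) → 0# · x ≡ 0Λ n
      ·-zeroˡ {zero}  = K.zeroˡ
      ·-zeroˡ {suc n} (a , b) = cong₂ _,_ (·-zeroˡ a) (·-zeroˡ b)

    -- Contracting w i ∧ X with w i leaves only the norm of w i times X: the other term contracts X
    -- with a vector orthogonal to all its factors.
    form-orthogonal : ∀ is → AllPairs (λ i j → G i j ≡ 0#) is →
      form D (wedge w is (1Λ n)) (wedge w is (1Λ n)) ≡ norms is
    form-orthogonal []       []         = form-1Λ D
    form-orthogonal (i ∷ is) (eq ∷ eqs) = begin
      form D (w i ∧ X) (w i ∧ X)                            ≡⟨ ∧-ι-adjoint D (w i) _ _ ⟩
      form D X (ι D (w i) (w i ∧ X))                        ≡⟨ cong (form D X) (ι-∧ D (w i) (w i) X) ⟩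
      form D X (dot D (w i) (w i) · X ⊞ ⊟ (w i ∧ ι D (w i) X))
        ≡⟨ cong₂ (λ α y → form D X (α · X ⊞ ⊟ (w i ∧ y))) (scalarProducts i i) (ι-orthogonal i is eq) ⟩
      form D X (G i i · X ⊞ ⊟ (w i ∧ 0Λ n))                 ≡⟨ cong (λ y → form D X (G i i · X ⊞ y)) (trans (cong ⊟_ (∧-zeroʳ (w i))) (·-zeroʳ _)) ⟩
      form D X (G i i · X ⊞ 0Λ n)                           ≡⟨ cong (form D X) (⊞-identityʳ (G i i · X)) ⟩
      form D X (G i i · X)                                  ≡⟨ form-·ʳ D (G i i) X X ⟩
      G i i * form D X X                                    ≡⟨ cong (G i i *_) (form-orthogonal is eqs) ⟩
      _                                                     ∎
      where X = wedge w is (1Λ n)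

  -- Grading, and the top coefficient as determinant.

  Homogeneous : ∀ n → ℕ → Λ n → Set
  Homogeneous zero    zero    x       = ⊤
  Homogeneous zero    (suc k) x       = x ≡ 0#
  Homogeneous (suc n) zero    (a , b) = Homogeneous n zero a × b ≡ 0Λ n
  Homogeneous (suc n) (suc k) (a , b) = Homogeneous n (suc k) a × Homogeneous n k b

  homogeneous-0Λ : ∀ n k → Homogeneous n k (0Λ n)
  homogeneous-0Λ zero    zero    = tt
  homogeneous-0Λ zero    (suc k) = refl
  homogeneous-0Λ (suc n) zero    = homogeneous-0Λ n 0 , refl
  homogeneous-0Λ (suc n) (suc k) = homogeneous-0Λ n (suc k) , homogeneous-0Λ n k

  homogeneous-1Λ : ∀ n → Homogeneous n 0 (1Λ n)
  homogeneous-1Λ zero    = tt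
  homogeneous-1Λ (suc n) = homogeneous-1Λ n , refl

  homogeneous-· : ∀ n k α x → Homogeneous n k x → Homogeneous n k (α · x)
  homogeneous-· zero    zero    α x hx        = tt
  homogeneous-· zero    (suc k) α x refl      = K.zeroʳ α
  homogeneous-· (suc n) zero    α (a , b) (ha , refl) = homogeneous-· n 0 α a ha , ·-zeroʳ α
  homogeneous-· (suc n) (suc k) α (a , b) (ha , hb)   = homogeneous-· n (suc k) α a ha , homogeneous-· n k α b hb

  homogeneous-⊞ : ∀ n k x y → Homogeneous n k x → Homogeneous n k y → Homogeneous n k (x ⊞ y)
  homogeneous-⊞ zero    zero    x y hx hy = tt
  homogeneous-⊞ zero    (suc k) x y refl refl = refl
  homogeneous-⊞ (suc n) zero    (a , b) (c , d) (ha , refl) (hc , refl) = homogeneous-⊞ n 0 a c ha hc , ⊞-identityˡ _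
  homogeneous-⊞ (suc n) (suc k) (a , b) (c , d) (ha , hb) (hc , hd) = homogeneous-⊞ n (suc k) a c ha hc , homogeneous-⊞ n k b d hb hd

  homogeneous-∧ : ∀ n k (v : Vector Quadratic n) x → Homogeneous n k x → Homogeneous n (suc k) (v ∧ x)
  homogeneous-∧ zero    k       v x hx = refl
  homogeneous-∧ (suc n) zero    v (a , b) (ha , refl) = homogeneous-∧ n 0 (tail v) a ha ,
    homogeneous-⊞ n 0 _ _ (homogeneous-· n 0 (head v) a ha) (homogeneous-· n 0 (- 1#) _ (subst (Homogeneous n 0) (sym (∧-zeroʳ (tail v))) (homogeneous-0Λ n 0)))
  homogeneous-∧ (suc n) (suc k) v (a , b) (ha , hb) = homogeneous-∧ n (suc k) (tail v) a ha ,
    homogeneous-⊞ n (suc k) _ _ (homogeneous-· n (suc k) (head v) a ha) (homogeneous-· n (suc k) (- 1#) _ (homogeneous-∧ n k (tail v) b hb))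

  homogeneous-wedge : ∀ (w : I → Vector Quadratic n) is → Homogeneous n (List.length is) (wedge w is (1Λ n))
  homogeneous-wedge {n = n} w []       = homogeneous-1Λ n
  homogeneous-wedge {n = n} w (i ∷ is) = homogeneous-∧ n _ (w i) _ (homogeneous-wedge w is)

  homogeneous-above : ∀ n k x → n ℕ.< k → Homogeneous n k x → x ≡ 0Λ n
  homogeneous-above zero    (suc k) x n<k refl = refl
  homogeneous-above (suc n) (suc k) (a , b) (s≤s n<k) (ha , hb) = cong₂ _,_
    (homogeneous-above n (suc k) a (ℕP.m<n⇒m<1+n n<k) ha) (homogeneous-above n k b n<k hb)

  -- On a wedge of n vectors in Λ n this is their determinant.
  topCoefficient : Λ n → Quadratic
  topCoefficient {zero}  x       = x
  topCoefficient {suc n} (a , b) = topCoefficient b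

  discriminant : Vector Quadratic n → Quadratic
  discriminant {zero}  D = 1#
  discriminant {suc n} D = head D * discriminant (tail D)

  -- In top degree one monomial is left: the part without the first basis vector has degree greater
  -- than the number of remaining variables, hence vanishes.
  form-top : ∀ n (D : Vector Quadratic n) x → Homogeneous n n x →
    form D x x ≡ discriminant D * (topCoefficient x * topCoefficient x)
  form-top zero    D x hx = sym (K.*-identityˡ _)
  form-top (suc n) D (a , b) (ha , hb) = begin
    form (tail D) a a + head D * form (tail D) b b
      ≡⟨ cong (λ z → form (tail D) a z + head D * form (tail D) b b) (homogeneous-above n (suc n) a (ℕP.n<1+n n) ha) ⟩
    form (tail D) a (0Λ n) + head D * form (tail D) b b
      ≡⟨ cong₂ (λ y z → y + head D * z) (form-zeroʳ (tail D) a) (form-top n (tail D) b hb) ⟩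
    0# + head D * (discriminant (tail D) * (topCoefficient b * topCoefficient b))
      ≡⟨ solve 3 (λ h d t → Κ 0# ⊕ h ⊗ (d ⊗ t) , h ⊗ d ⊗ t) refl (head D) (discriminant (tail D)) (topCoefficient b * topCoefficient b) ⟩
    _ ∎

  module _ (P : Quadratic → Set) (P0 : P 0#) (P1 : P 1#) (P- : ∀ {x} → P x → P (- x))
           (P+ : ∀ {x y} → P x → P y → P (x + y)) (P* : ∀ {x y} → P x → P y → P (x * y)) where

    AllΛ : ∀ n → Λ n → Set
    AllΛ zero    x       = P x
    AllΛ (suc n) (a , b) = AllΛ n a × AllΛ n b

    private
      all-0Λ : ∀ n → AllΛ n (0Λ n)
      all-0Λ zero    = P0
      all-0Λ (suc n) = all-0Λ n , all-0Λ n

      all-1Λ : ∀ n → AllΛ n (1Λ n)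
      all-1Λ zero    = P1
      all-1Λ (suc n) = all-1Λ n , all-0Λ n

      all-⊞ : ∀ n x y → AllΛ n x → AllΛ n y → AllΛ n (x ⊞ y)
      all-⊞ zero    x y px py = P+ px py
      all-⊞ (suc n) (a , b) (c , d) (pa , pb) (pc , pd) = all-⊞ n a c pa pc , all-⊞ n b d pb pd

      all-· : ∀ n α x → P α → AllΛ n x → AllΛ n (α · x)
      all-· zero    α x pα px = P* pα px
      all-· (suc n) α (a , b) pα (pa , pb) = all-· n α a pα pa , all-· n α b pα pb

      all-∧ : ∀ n v x → (∀ i → P (v i)) → AllΛ n x → AllΛ n (v ∧ x)
      all-∧ zero    v x pv px = P0
      all-∧ (suc n) v (a , b) pv (pa , pb) = all-∧ n (tail v) a (pv ∘ suc) pa ,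
        all-⊞ n _ _ (all-· n (head v) a (pv zero) pa) (all-· n (- 1#) _ (P- P1) (all-∧ n (tail v) b (pv ∘ suc) pb))

      all-wedge : ∀ {w : I → Vector Quadratic n} → (∀ i j → P (w i j)) → ∀ is → AllΛ n (wedge w is (1Λ n))
      all-wedge {n = n} pw []       = all-1Λ n
      all-wedge {n = n} pw (i ∷ is) = all-∧ n _ _ (pw i) (all-wedge pw is)

      all-top : ∀ n x → AllΛ n x → P (topCoefficient x)
      all-top zero    x px              = px
      all-top (suc n) (a , b) (pa , pb) = all-top n b pb

    -- A determinant is a polynomial in its entries with integer coefficients, so it stays in any
    -- subring that contains them. It serves to show that the incidence determinant is an integer.
    topCoefficient-closed : ∀ {w : I → Vector Quadratic n} → (∀ i j → P (w i j)) → ∀ is → P (topCoefficient (wedge w is (1Λ n)))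
    topCoefficient-closed {n = n} pw is = all-top n _ (all-wedge pw is)

  -- The determinant of x - σ along cycles.

  cycleProduct : Quadratic → List ℕ → Quadratic
  cycleProduct x = foldr (λ ℓ α → (x ^ ℓ - 1#) * α) 1#

  module _ (x : Quadratic) (e : I → Vector Quadratic n) (σ : I → I) where

    edge : I → Vector Quadratic n
    edge i j = x * e i j - e (σ i) j

    private
      edge-∧ : ∀ i j y → σ i ≡ j → edge i ∧ y ≡ x · e i ∧ y ⊞ ⊟ (e j ∧ y)
      edge-∧ i _ y refl = ∧-linearˡ x (e i) (e (σ i)) y

      -- Of the expansion of the wedge of the edges along a path from i to z, only
      -- one term survives multiplication by e z, and only one by e i.
      end∧path : ∀ i is z y → Path σ i is z →
        e z ∧ wedge edge (i ∷ is) y ≡ x ^ List.length (i ∷ is) · e z ∧ wedge e (i ∷ is) y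
      end∧path i [] z y eq = begin
        e z ∧ edge i ∧ y                              ≡⟨ cong (e z ∧_) (edge-∧ i z y eq) ⟩
        e z ∧ (x · e i ∧ y ⊞ ⊟ (e z ∧ y))             ≡⟨ trans (∧-distribˡ-⊞ (e z) _ _) (cong₂ _⊞_ (∧-· (e z) _ _) (∧-· (e z) _ _)) ⟩
        x · e z ∧ e i ∧ y ⊞ ⊟ (e z ∧ e z ∧ y)         ≡⟨ ⊞-congʳ (trans (cong ⊟_ (∧-self (e z) y)) (·-zeroʳ _)) ⟩
        x · e z ∧ e i ∧ y ⊞ 0Λ n                      ≡⟨ ⊞-identityʳ _ ⟩
        x · e z ∧ e i ∧ y                             ≡⟨ cong (_· e z ∧ e i ∧ y) (K.*-identityʳ x) ⟨
        (x * 1#) · e z ∧ e i ∧ y                      ∎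
      end∧path i (j ∷ js) z y (eq , path) = begin
        e z ∧ edge i ∧ Q                              ≡⟨ ∧-anticomm (e z) (edge i) Q ⟩
        ⊟ (edge i ∧ e z ∧ Q)                          ≡⟨ cong (λ q → ⊟ (edge i ∧ q)) (end∧path j js z y path) ⟩
        ⊟ (edge i ∧ (xᵏ · e z ∧ W))                   ≡⟨ cong ⊟_ (∧-· (edge i) _ _) ⟩
        ⊟ (xᵏ · edge i ∧ e z ∧ W)                     ≡⟨ ·-comm (- 1#) xᵏ _ ⟩
        xᵏ · ⊟ (edge i ∧ e z ∧ W)                     ≡⟨ cong (xᵏ ·_) (∧-anticomm (e z) (edge i) W) ⟨
        xᵏ · e z ∧ edge i ∧ W                         ≡⟨ cong (λ q → xᵏ · e z ∧ q) (edge-∧ i j W eq) ⟩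
        xᵏ · e z ∧ (x · e i ∧ W ⊞ ⊟ (e j ∧ W))        ≡⟨ cong (λ q → xᵏ · e z ∧ (x · e i ∧ W ⊞ ⊟ q)) (∧-self (e j) (wedge e js y)) ⟩
        xᵏ · e z ∧ (x · e i ∧ W ⊞ ⊟ 0Λ n)             ≡⟨ cong (λ q → xᵏ · e z ∧ q) (trans (⊞-congʳ (·-zeroʳ _)) (⊞-identityʳ _)) ⟩
        xᵏ · e z ∧ (x · e i ∧ W)                      ≡⟨ cong (xᵏ ·_) (∧-· (e z) x _) ⟩
        xᵏ · x · e z ∧ e i ∧ W                        ≡⟨ ·-comm xᵏ x _ ⟩
        x · xᵏ · e z ∧ e i ∧ W                        ≡⟨ ·-assoc x xᵏ _ ⟨
        (x * xᵏ) · e z ∧ e i ∧ W                      ∎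
        where
        Q  = wedge edge (j ∷ js) y
        W  = wedge e (j ∷ js) y
        xᵏ = x ^ List.length (j ∷ js)

      start∧path : ∀ i is z y → Path σ i is z → e i ∧ wedge edge (i ∷ is) y ≡ e z ∧ wedge e (i ∷ is) y
      start∧edge : ∀ i j y → σ i ≡ j → e i ∧ edge i ∧ y ≡ ⊟ (e i ∧ e j ∧ y)
      start∧edge i j y eq = begin
        e i ∧ edge i ∧ y                              ≡⟨ cong (e i ∧_) (edge-∧ i j y eq) ⟩
        e i ∧ (x · e i ∧ y ⊞ ⊟ (e j ∧ y))             ≡⟨ trans (∧-distribˡ-⊞ (e i) _ _) (cong₂ _⊞_ (∧-· (e i) _ _) (∧-· (e i) _ _)) ⟩
        x · e i ∧ e i ∧ y ⊞ ⊟ (e i ∧ e j ∧ y)         ≡⟨ ⊞-congˡ (trans (cong (x ·_) (∧-self (e i) y)) (·-zeroʳ _)) ⟩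
        0Λ n ⊞ ⊟ (e i ∧ e j ∧ y)                      ≡⟨ ⊞-identityˡ _ ⟩
        ⊟ (e i ∧ e j ∧ y)                             ∎
      start∧path i [] z y eq = trans (start∧edge i z y eq) (sym (∧-anticomm (e z) (e i) y))
      start∧path i (j ∷ js) z y (eq , path) = begin
        e i ∧ edge i ∧ wedge edge (j ∷ js) y          ≡⟨ start∧edge i j _ eq ⟩
        ⊟ (e i ∧ e j ∧ wedge edge (j ∷ js) y)         ≡⟨ cong (λ q → ⊟ (e i ∧ q)) (start∧path j js z y path) ⟩
        ⊟ (e i ∧ e z ∧ wedge e (j ∷ js) y)            ≡⟨ ∧-anticomm (e z) (e i) _ ⟨
        e z ∧ e i ∧ wedge e (j ∷ js) y                ∎

    -- Splitting the first edge into x e i - e j leaves the path from j back to i multiplied by its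
    -- endpoint e i in one term and by its start e j in the other. Each term reduces to the same
    -- wedge, with coefficients x^ℓ and 1.
    wedge-cycle : ∀ is → Cycle σ is → ∀ y → wedge edge is y ≡ (x ^ List.length is - 1#) · wedge e is y
    wedge-cycle (i ∷ j ∷ js) (eq , path) y = begin
      edge i ∧ Q                                      ≡⟨ edge-∧ i j Q eq ⟩
      x · e i ∧ Q ⊞ ⊟ (e j ∧ Q)                       ≡⟨ cong₂ (λ p q → x · p ⊞ ⊟ q) (end∧path j js i y path) (start∧path j js i y path) ⟩
      x · xᵏ · e i ∧ W ⊞ ⊟ (e i ∧ W)                  ≡⟨ cong₂ (λ p q → p ⊞ ⊟ q) (·-assoc x xᵏ _) (·-identity _) ⟨
      (x * xᵏ) · e i ∧ W ⊞ ⊟ (1# · e i ∧ W)           ≡⟨ ·-distrib-minus (x * xᵏ) 1# _ ⟨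
      (x * xᵏ - 1#) · e i ∧ W                         ∎
      where
      Q  = wedge edge (j ∷ js) y
      W  = wedge e (j ∷ js) y
      xᵏ = x ^ List.length (j ∷ js)

    wedge-cycles : ∀ iss → All (Cycle σ) iss → ∀ y → wedge edge (concat iss) y ≡ cycleProduct x (map List.length iss) · wedge e (concat iss) y
    wedge-cycles []         []           y = sym (·-identity y)
    wedge-cycles (is ∷ iss) (cyc ∷ cycs) y = begin
      wedge edge (is ++ concat iss) y                       ≡⟨ wedge-++ edge is (concat iss) y ⟩
      wedge edge is (wedge edge (concat iss) y)             ≡⟨ wedge-cycle is cyc _ ⟩
      α · wedge e is (wedge edge (concat iss) y)            ≡⟨ cong (λ q → α · wedge e is q) (wedge-cycles iss cycs y) ⟩
      α · wedge e is (δ · wedge e (concat iss) y)           ≡⟨ cong (α ·_) (wedge-· e is δ _) ⟩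
      α · δ · wedge e is (wedge e (concat iss) y)           ≡⟨ ·-assoc α δ _ ⟨
      (α * δ) · wedge e is (wedge e (concat iss) y)         ≡⟨ cong ((α * δ) ·_) (wedge-++ e is (concat iss) y) ⟨
      (α * δ) · wedge e (is ++ concat iss) y                ∎
      where
      α = x ^ List.length is - 1#
      δ = cycleProduct x (map List.length iss)

-- Squares, conjugation and positivity.

-- (k + 2)² < (k + 1) (k + 5) < (k + 3)²
not-square : ∀ k c → c ℕ.* c ≢ suc k ℕ.* (5 ℕ.+ k)
not-square k c eq with c ℕP.≤? 2 ℕ.+ k
... | yes c≤ = ℕP.<-irrefl eq (ℕP.≤-<-trans (ℕP.*-mono-≤ c≤ c≤)
  (subst ((2 ℕ.+ k) ℕ.* (2 ℕ.+ k) ℕ.<_) (sym (expand k)) (s≤s (ℕP.m≤m+n _ (2 ℕ.* k)))))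
  where
  expand : ∀ k → suc k ℕ.* (5 ℕ.+ k) ≡ suc ((2 ℕ.+ k) ℕ.* (2 ℕ.+ k) ℕ.+ 2 ℕ.* k)
  expand = ℕSolver.solve-∀
... | no c≰ = ℕP.<-irrefl (sym eq) (ℕP.<-≤-trans
  (subst (suc k ℕ.* (5 ℕ.+ k) ℕ.<_) (expand k) (s≤s (ℕP.m≤m+n _ 3))) (ℕP.*-mono-≤ (ℕP.≰⇒> c≰) (ℕP.≰⇒> c≰)))
  where
  expand : ∀ k → suc (suc k ℕ.* (5 ℕ.+ k) ℕ.+ 3) ≡ (3 ℕ.+ k) ℕ.* (3 ℕ.+ k)
  expand = ℕSolver.solve-∀

-- After division by the gcd, a′ is coprime to c′ and divides c′ · c′, hence divides c′ and equals
-- 1.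
square-ratio : ∀ D a c → .{{NonZero a}} → c ℕ.* c ≡ D ℕ.* (a ℕ.* a) → ∃[ b ] b ℕ.* b ≡ D
square-ratio D a c eq = c′ , trans reduced (trans (cong (λ z → D ℕ.* (z ℕ.* z)) a′≡1) (ℕP.*-identityʳ D))
  where
  g = gcd a c
  instance
    g≢0 : NonZero g
    g≢0 = ℕ.≢-nonZero (gcd[m,n]≢0 a c (inj₁ (ℕ.≢-nonZero⁻¹ a)))
  a′ = a / g
  c′ = c / g
  open ≡-Reasoning
  reduced : c′ ℕ.* c′ ≡ D ℕ.* (a′ ℕ.* a′)
  reduced = ℕP.*-cancelʳ-≡ _ _ (g ℕ.* g) {{ℕP.m*n≢0 g g}} (begin
    c′ ℕ.* c′ ℕ.* (g ℕ.* g)           ≡⟨ rearrange₁ c′ g ⟩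
    (c′ ℕ.* g) ℕ.* (c′ ℕ.* g)         ≡⟨ cong (λ z → z ℕ.* z) (m/n*n≡m (gcd[m,n]∣n a c)) ⟩
    c ℕ.* c                           ≡⟨ eq ⟩
    D ℕ.* (a ℕ.* a)                   ≡⟨ cong (λ z → D ℕ.* (z ℕ.* z)) (m/n*n≡m (gcd[m,n]∣m a c)) ⟨
    D ℕ.* ((a′ ℕ.* g) ℕ.* (a′ ℕ.* g)) ≡⟨ rearrange₂ D a′ g ⟩
    D ℕ.* (a′ ℕ.* a′) ℕ.* (g ℕ.* g)   ∎)
    where
    rearrange₁ : ∀ c g → c ℕ.* c ℕ.* (g ℕ.* g) ≡ (c ℕ.* g) ℕ.* (c ℕ.* g)
    rearrange₁ = ℕSolver.solve-∀
    rearrange₂ : ∀ D a g → D ℕ.* ((a ℕ.* g) ℕ.* (a ℕ.* g)) ≡ D ℕ.* (a ℕ.* a) ℕ.* (g ℕ.* g)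
    rearrange₂ = ℕSolver.solve-∀
  coprime : Coprime a′ c′
  coprime = coprime-/gcd a c
  a′≡1 : a′ ≡ 1
  a′≡1 = coprime (∣-refl , coprime-divisor coprime (divides (D ℕ.* a′) (trans reduced (sym (ℕP.*-assoc D a′ a′)))))

private module ℤ-identities where
  open import Data.Integer using (_+_; _*_; _-_; -_)
  conj-*₁ : ∀ a b c d ν → a * c - b * d + (a * d + b * c + b * d * ν) * ν ≡ (a + b * ν) * (c + d * ν) - (- b) * (- d)
  conj-*₁ = ℤSolver.solve-∀
  conj-*₂ : ∀ a b c d ν → - (a * d + b * c + b * d * ν) ≡ (a + b * ν) * (- d) + (- b) * (c + d * ν) + (- b) * (- d) * ν
  conj-*₂ = ℤSolver.solve-∀
  conj-minus₁ : ∀ a b c d ν → a - c + (b - d) * ν ≡ a + b * ν - (c + d * ν)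
  conj-minus₁ = ℤSolver.solve-∀
  positive-*₁ : ∀ q s q′ s′ → (- q) * (- q′) - (q + s) * (q′ + s′) ≡ - (q * s′ + q′ * s + s * s′)
  positive-*₁ = ℤSolver.solve-∀
  positive-*₂ : ∀ q s q′ s′ k → (- q) * (q′ + s′) + (q + s) * (- q′) + (q + s) * (q′ + s′) * (+ 3 + k)
    ≡ (q * s′ + q′ * s + s * s′) + ((q + s) * (q′ + s′) + k * ((q + s) * (q′ + s′)) + s * s′)
  positive-*₂ = ℤSolver.solve-∀
  norm₁ : ∀ c → c * c ≡ c * c - + 0 * + 0
  norm₁ = ℤSolver.solve-∀
  norm₂ : ∀ a k → (+ 1 + k) * (a * (a + a * (+ 3 + k)) - a * (- a)) - + 0 * (a * (- a) + a * (a + a * (+ 3 + k)) + a * (- a) * (+ 3 + k))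
         ≡ (+ 1 + k) * (+ 5 + k) * (a * a)
  norm₂ = ℤSolver.solve-∀

-- n = k + 3
module Irrationality (k : ℕ) where
  ν : ℤ
  ν = + (3 ℕ.+ k)
  open ℤ-identities
  open QuadraticRing ν
  open Exterior ν using (cycleProduct)
  open Exp K.semiring using (_^_; ^-homo-*)
  open CommutativeExp K.commutativeSemiring using (^-distrib-*)

  -- The ring automorphism that exchanges the two roots x and ν - x = x⁻¹ of the defining
  -- polynomial.
  conj : Quadratic → Quadratic
  conj ⟦ a , b ⟧ = ⟦ a ℤ.+ b ℤ.* ν , ℤ.- b ⟧

  x x̄ : Quadratic
  x = ⟦ + 0 , + 1 ⟧
  x̄ = conj x

  xx̄≡1 : x * x̄ ≡ 1#
  xx̄≡1 = cong₂ ⟦_,_⟧ refl (lemma ν)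
    where
    lemma : ∀ ν → + 0 ℤ.* (ℤ.- + 1) ℤ.+ + 1 ℤ.* (+ 0 ℤ.+ + 1 ℤ.* ν) ℤ.+ + 1 ℤ.* (ℤ.- + 1) ℤ.* ν ≡ + 0
    lemma = ℤSolver.solve-∀

  conj-* : ∀ u w → conj (u * w) ≡ conj u * conj w
  conj-* ⟦ a , b ⟧ ⟦ c , d ⟧ = cong₂ ⟦_,_⟧ (conj-*₁ a b c d ν) (conj-*₂ a b c d ν)

  conj-1 : conj 1# ≡ 1#
  conj-1 = refl

  conj-minus : ∀ u w → conj (u - w) ≡ conj u - conj w
  conj-minus ⟦ a , b ⟧ ⟦ c , d ⟧ = cong₂ ⟦_,_⟧ (conj-minus₁ a b c d ν) (ℤP.neg-distrib-+ b (ℤ.- d))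

  conj-^ : ∀ u n → conj (u ^ n) ≡ conj u ^ n
  conj-^ u zero    = conj-1
  conj-^ u (suc n) = trans (conj-* u (u ^ n)) (cong (conj u *_) (conj-^ u n))

  x^nx̄^n≡1 : ∀ n → x ^ n * x̄ ^ n ≡ 1#
  x^nx̄^n≡1 n = trans (sym (^-distrib-* x x̄ n)) (trans (cong (_^ n) xx̄≡1) (1^n n))
    where
    1^n : ∀ n → 1# ^ n ≡ 1#
    1^n zero    = refl
    1^n (suc n) = trans (K.*-identityˡ _) (1^n n)

  -- By x x̄ = 1 each factor satisfies x^ℓ - 1 = -x^ℓ (x̄^ℓ - 1). The sign, one per cycle, is what
  -- records the parity of the number of cycles.
  cycleProduct-conj : ∀ ls → cycleProduct x ls ≡ (- 1#) ^ List.length ls * (x ^ sumˡ ls * conj (cycleProduct x ls))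
  cycleProduct-conj []       = refl
  cycleProduct-conj (ℓ ∷ ls) = begin
    (x ^ ℓ - 1#) * δ
      ≡⟨ cong₂ (λ u w → (x ^ ℓ - u) * w) (sym (x^nx̄^n≡1 ℓ)) (cycleProduct-conj ls) ⟩
    (x ^ ℓ - x ^ ℓ * x̄ ^ ℓ) * (s * (x ^ sumˡ ls * conj δ))
      ≡⟨ solve 5 (λ p q s r d → (p ⊕ ⊝ (p ⊗ q)) ⊗ (s ⊗ (r ⊗ d)) , ⊝ Κ 1# ⊗ s ⊗ (p ⊗ r ⊗ ((q ⊕ ⊝ Κ 1#) ⊗ d))) refl (x ^ ℓ) (x̄ ^ ℓ) s (x ^ sumˡ ls) (conj δ) ⟩
    - 1# * s * (x ^ ℓ * x ^ sumˡ ls * ((x̄ ^ ℓ - 1#) * conj δ))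
      ≡⟨ cong₂ (λ u w → - 1# * s * (u * w)) (sym (^-homo-* x ℓ (sumˡ ls)))
           (trans (cong (_* conj δ) (sym (trans (conj-minus (x ^ ℓ) 1#) (cong (_- 1#) (conj-^ x ℓ))))) (sym (conj-* (x ^ ℓ - 1#) δ))) ⟩
    - 1# * s * (x ^ (ℓ ℕ.+ sumˡ ls) * conj ((x ^ ℓ - 1#) * δ)) ∎
    where
    open ≡-Reasoning
    δ = cycleProduct x ls
    s = (- 1#) ^ List.length ls

  -- The elements sx + q(x − 1) with s, q ≥ 0 not both zero: closed under the
  -- ring operations needed because x, in the real embedding, exceeds 1.
  Positive : Quadratic → Set
  Positive u = ∃₂ λ q s → u ≡ ⟦ ℤ.- + q , + (q ℕ.+ s) ⟧ × NonZero (q ℕ.+ s)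

  positive-+ : ∀ {u w} → Positive u → Positive w → Positive (u + w)
  positive-+ (q , s , refl , nz) (q′ , s′ , refl , _) = q ℕ.+ q′ , s ℕ.+ s′ ,
    cong₂ ⟦_,_⟧ (sym (ℤP.neg-distrib-+ (+ q) (+ q′))) (cong +_ (lemma q s q′ s′)) ,
    subst NonZero (lemma q s q′ s′) (ℕ.≢-nonZero λ eq → ℕ.≢-nonZero⁻¹ (q ℕ.+ s) {{nz}} (ℕP.m+n≡0⇒m≡0 _ eq))
    where
    lemma : ∀ q s q′ s′ → q ℕ.+ s ℕ.+ (q′ ℕ.+ s′) ≡ q ℕ.+ q′ ℕ.+ (s ℕ.+ s′)
    lemma = ℕSolver.solve-∀

  positive-* : ∀ {u w} → Positive u → Positive w → Positive (u * w)
  positive-* (q , s , refl , nz) (q′ , s′ , refl , nz′) = q″ , s″ ,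
    cong₂ ⟦_,_⟧
      (trans (positive-*₁ (+ q) (+ s) (+ q′) (+ s′)) (cong ℤ.-_ (sym +q″)))
      (trans (positive-*₂ (+ q) (+ s) (+ q′) (+ s′) (+ k)) (sym (cong₂ ℤ._+_ +q″ +s″))) ,
    ℕ.≢-nonZero λ eq → ℕ.≢-nonZero⁻¹ (p ℕ.* p′) {{ℕP.m*n≢0 p p′ {{nz}} {{nz′}}}} (ℕP.m+n≡0⇒m≡0 _ (ℕP.m+n≡0⇒m≡0 _ (ℕP.m+n≡0⇒n≡0 q″ eq)))
    where
    p  = q ℕ.+ s
    p′ = q′ ℕ.+ s′
    -- `q″` is minus the constant term qq′ - pp′ of the product, and `s″` is what remains of the
    -- coefficient of x. The summand pp′ of `s″`, present because ν - 2 = k + 1, keeps the product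
    -- nonzero.
    q″ = q ℕ.* s′ ℕ.+ q′ ℕ.* s ℕ.+ s ℕ.* s′
    s″ = p ℕ.* p′ ℕ.+ k ℕ.* (p ℕ.* p′) ℕ.+ s ℕ.* s′
    +q″ : + q″ ≡ + q ℤ.* + s′ ℤ.+ + q′ ℤ.* + s ℤ.+ + s ℤ.* + s′
    +q″ = cong₂ ℤ._+_ (cong₂ ℤ._+_ (ℤP.pos-* q s′) (ℤP.pos-* q′ s)) (ℤP.pos-* s s′)
    +s″ : + s″ ≡ (+ q ℤ.+ + s) ℤ.* (+ q′ ℤ.+ + s′) ℤ.+ + k ℤ.* ((+ q ℤ.+ + s) ℤ.* (+ q′ ℤ.+ + s′)) ℤ.+ + s ℤ.* + s′
    +s″ = cong₂ ℤ._+_ (cong₂ ℤ._+_ (ℤP.pos-* p p′) (trans (ℤP.pos-* k (p ℕ.* p′)) (cong (+ k ℤ.*_) (ℤP.pos-* p p′)))) (ℤP.pos-* s s′)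

  positive-x : Positive x
  positive-x = 0 , 1 , refl , _

  positive-x^n-1 : ∀ n → Positive (x ^ suc n - 1#)
  positive-x^n-1 zero    = 1 , 0 , cong₂ ⟦_,_⟧ refl (lemma ν) , _
    where
    lemma : ∀ ν → + 0 ℤ.* + 0 ℤ.+ + 1 ℤ.* + 1 ℤ.+ + 1 ℤ.* + 0 ℤ.* ν ℤ.+ + 0 ≡ + 1
    lemma = ℤSolver.solve-∀
  positive-x^n-1 (suc n) = subst Positive
    (solve 2 (λ x y → x ⊗ (x ⊗ y ⊕ ⊝ Κ 1#) ⊕ (x ⊗ Κ 1# ⊕ ⊝ Κ 1#) , x ⊗ (x ⊗ y) ⊕ ⊝ Κ 1#) refl x (x ^ n))
    (positive-+ (positive-* positive-x (positive-x^n-1 n)) (positive-x^n-1 zero))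

  -- The accumulated factor `u` is there because `1#` is not `Positive`, so the empty product cannot
  -- start the induction; `u` = x can.
  positive-*cycleProduct : ∀ u ls → All NonZero ls → Positive u → Positive (u * cycleProduct x ls)
  positive-*cycleProduct u []           []         pu = subst Positive (sym (K.*-identityʳ u)) pu
  positive-*cycleProduct u (suc ℓ ∷ ls) (_ ∷ nzs) pu = subst Positive (K.*-assoc u _ _)
    (positive-*cycleProduct _ ls nzs (positive-* pu (positive-x^n-1 ℓ)))

  positive≢0 : ∀ {u} → Positive u → u ≢ 0#
  positive≢0 (q , s , refl , nz) eq = ℕ.≢-nonZero⁻¹ (q ℕ.+ s) {{nz}} (ℤP.+-injective (co-injective eq))
    where
    co-injective : ∀ {a b c d} → ⟦ a , b ⟧ ≡ ⟦ c , d ⟧ → b ≡ d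
    co-injective refl = refl

  -- For an even number of factors ε = x^(−h) ∏ (x^ℓ − 1) satisfies ε = x · conj ε,
  -- which forces ε = a (1 + x) with an integer a, of norm (n + 2) a².
  no-even-cycleProduct : ∀ ls → All NonZero ls → ∀ h t → sumˡ ls ≡ suc (h ℕ.+ h) → List.length ls ≡ 2 ℕ.* t → ∀ c →
    ⟦ c , + 0 ⟧ * ⟦ c , + 0 ⟧ ≢ ⟦ + (1 ℕ.+ k) , + 0 ⟧ * (x̄ ^ sumˡ ls * (cycleProduct x ls * cycleProduct x ls))
  no-even-cycleProduct ls nzs h t sum-ls length-ls c eq with x̄ ^ h * cycleProduct x ls in eqε
  ... | ε@(⟦ a , b ⟧) =
    let b , b²≡ = square-ratio _ ℤ.∣ a ∣ ℤ.∣ c ∣ {{a≢0}} c² in not-square k b b²≡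
    where
    open ≡-Reasoning
    δ = cycleProduct x ls
    δ≡ : δ ≡ x ^ suc (h ℕ.+ h) * conj δ
    δ≡ = begin
      δ                                                          ≡⟨ cycleProduct-conj ls ⟩
      (- 1#) ^ List.length ls * (x ^ sumˡ ls * conj δ)       ≡⟨ cong₂ (λ m n → (- 1#) ^ m * (x ^ n * conj δ)) (trans length-ls (ℕP.*-comm 2 t)) sum-ls ⟩
      (- 1#) ^ (t ℕ.* 2) * (x ^ suc (h ℕ.+ h) * conj δ)          ≡⟨ cong (_* (x ^ suc (h ℕ.+ h) * conj δ)) (even-power t) ⟩
      1# * (x ^ suc (h ℕ.+ h) * conj δ)                          ≡⟨ K.*-identityˡ _ ⟩
      x ^ suc (h ℕ.+ h) * conj δ                                 ∎
      where
      even-power : ∀ t → (- 1#) ^ (t ℕ.* 2) ≡ 1#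
      even-power zero    = refl
      even-power (suc t) = trans (cong (λ u → - 1# * (- 1# * u)) (even-power t)) refl
    ε≡ : ε ≡ x * conj ε
    ε≡ = begin
      ε                                                   ≡⟨ eqε ⟨
      x̄ ^ h * δ                                           ≡⟨ cong (x̄ ^ h *_) δ≡ ⟩
      x̄ ^ h * (x * x ^ (h ℕ.+ h) * conj δ)                ≡⟨ cong (λ u → x̄ ^ h * (x * u * conj δ)) (^-homo-* x h h) ⟩
      x̄ ^ h * (x * (x ^ h * x ^ h) * conj δ)              ≡⟨ solve 4 (λ q x p d → q ⊗ (x ⊗ (p ⊗ p) ⊗ d) , p ⊗ q ⊗ (x ⊗ (p ⊗ d))) refl (x̄ ^ h) x (x ^ h) (conj δ) ⟩
      x ^ h * x̄ ^ h * (x * (x ^ h * conj δ))              ≡⟨ cong (_* (x * (x ^ h * conj δ))) (x^nx̄^n≡1 h) ⟩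
      1# * (x * (x ^ h * conj δ))                         ≡⟨ K.*-identityˡ _ ⟩
      x * (x ^ h * conj δ)                                ≡⟨ cong (λ u → x * (u * conj δ)) (trans (conj-^ x̄ h) (cong (_^ h) conj-x̄)) ⟨
      x * (conj (x̄ ^ h) * conj δ)                         ≡⟨ cong (x *_) (conj-* (x̄ ^ h) δ) ⟨
      x * conj (x̄ ^ h * δ)                                ≡⟨ cong (λ u → x * conj u) eqε ⟩
      x * conj ε                                          ∎
      where
      conj-x̄ : conj x̄ ≡ x
      conj-x̄ = cong₂ ⟦_,_⟧ (lemma ν) refl
        where
        lemma : ∀ ν → + 0 ℤ.+ + 1 ℤ.* ν ℤ.+ (ℤ.- + 1) ℤ.* ν ≡ + 0
        lemma = ℤSolver.solve-∀
    re co : Quadratic → ℤ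
    re ⟦ a , b ⟧ = a
    co ⟦ a , b ⟧ = b
    -- The constant terms of ε = x · conj ε suffice: that of x (a + bν - bx) is b, since x² = νx -
    -- 1.
    a≡b : a ≡ b
    a≡b = trans (cong re ε≡) (lemma a b ν)
      where
      lemma : ∀ a b ν → + 0 ℤ.* (a ℤ.+ b ℤ.* ν) ℤ.- + 1 ℤ.* (ℤ.- b) ≡ b
      lemma = ℤSolver.solve-∀
    -- If a = 0 then ε = 0; undoing the factor x̄^h gives x · δ = 0, where x is the positive element
    -- needed as starting value.
    a≢0 : NonZero ℤ.∣ a ∣
    a≢0 = ℕ.≢-nonZero λ ∣a∣≡0 → positive≢0 (positive-*cycleProduct x ls nzs positive-x) (begin
      x * δ                               ≡⟨ cong (x *_) (K.*-identityˡ δ) ⟨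
      x * (1# * δ)                        ≡⟨ cong (λ u → x * (u * δ)) (x^nx̄^n≡1 h) ⟨
      x * (x ^ h * x̄ ^ h * δ)             ≡⟨ cong (x *_) (K.*-assoc _ _ _) ⟩
      x * (x ^ h * (x̄ ^ h * δ))           ≡⟨ cong (λ u → x * (x ^ h * u)) (trans eqε (cong₂ ⟦_,_⟧ (ℤP.∣i∣≡0⇒i≡0 ∣a∣≡0) (trans (sym a≡b) (ℤP.∣i∣≡0⇒i≡0 ∣a∣≡0)))) ⟩
      x * (x ^ h * 0#)                    ≡⟨ trans (cong (x *_) (K.zeroʳ (x ^ h))) (K.zeroʳ x) ⟩
      0#                                  ∎)
    -- As v = 2h + 1, the power of x̄ supplies x̄^h to each of the two factors δ, and the one left
    -- over turns the second ε into conj ε.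
    c²′ : ⟦ c , + 0 ⟧ * ⟦ c , + 0 ⟧ ≡ ⟦ + (1 ℕ.+ k) , + 0 ⟧ * (ε * conj ε)
    c²′ = begin
      _                                              ≡⟨ eq ⟩
      N * (x̄ ^ sumˡ ls * (δ * δ))                ≡⟨ cong (λ n → N * (x̄ ^ n * (δ * δ))) sum-ls ⟩
      N * (x̄ * x̄ ^ (h ℕ.+ h) * (δ * δ))              ≡⟨ cong (λ u → N * (x̄ * u * (δ * δ))) (^-homo-* x̄ h h) ⟩
      N * (x̄ * (x̄ ^ h * x̄ ^ h) * (δ * δ))            ≡⟨ solve 4 (λ n x q d → n ⊗ (x ⊗ (q ⊗ q) ⊗ (d ⊗ d)) , n ⊗ (q ⊗ d ⊗ (x ⊗ (q ⊗ d)))) refl N x̄ (x̄ ^ h) δ ⟩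
      N * (x̄ ^ h * δ * (x̄ * (x̄ ^ h * δ)))            ≡⟨ cong (λ u → N * (u * (x̄ * u))) eqε ⟩
      N * (ε * (x̄ * ε))                              ≡⟨ cong (λ u → N * (ε * (x̄ * u))) ε≡ ⟩
      N * (ε * (x̄ * (x * conj ε)))                   ≡⟨ cong (λ u → N * (ε * u)) (solve 3 (λ y x e → y ⊗ (x ⊗ e) , x ⊗ y ⊗ e) refl x̄ x (conj ε)) ⟩
      N * (ε * (x * x̄ * conj ε))                     ≡⟨ cong (λ u → N * (ε * (u * conj ε))) xx̄≡1 ⟩
      N * (ε * (1# * conj ε))                        ≡⟨ cong (λ u → N * (ε * u)) (K.*-identityˡ (conj ε)) ⟩
      N * (ε * conj ε)                               ∎
      where N = ⟦ + (1 ℕ.+ k) , + 0 ⟧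
    c² : ℤ.∣ c ∣ ℕ.* ℤ.∣ c ∣ ≡ suc k ℕ.* (5 ℕ.+ k) ℕ.* (ℤ.∣ a ∣ ℕ.* ℤ.∣ a ∣)
    c² = begin
      ℤ.∣ c ∣ ℕ.* ℤ.∣ c ∣                                       ≡⟨ ℤP.abs-* c c ⟨
      ℤ.∣ c ℤ.* c ∣                                             ≡⟨ cong ℤ.∣_∣ (begin
        c ℤ.* c                                                 ≡⟨ norm₁ c ⟩
        c ℤ.* c ℤ.- + 0 ℤ.* + 0                                 ≡⟨ cong re c²′ ⟩
        re (⟦ + (1 ℕ.+ k) , + 0 ⟧ * (ε * conj ε))               ≡⟨ cong (λ z → re (⟦ + (1 ℕ.+ k) , + 0 ⟧ * (⟦ a , z ⟧ * conj ⟦ a , z ⟧))) a≡b ⟨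
        re (⟦ + (1 ℕ.+ k) , + 0 ⟧ * (⟦ a , a ⟧ * conj ⟦ a , a ⟧)) ≡⟨ norm₂ a (+ k) ⟩
        (+ 1 ℤ.+ + k) ℤ.* (+ 5 ℤ.+ + k) ℤ.* (a ℤ.* a)           ∎) ⟩
      ℤ.∣ (+ 1 ℤ.+ + k) ℤ.* (+ 5 ℤ.+ + k) ℤ.* (a ℤ.* a) ∣       ≡⟨ trans (ℤP.abs-* ((+ 1 ℤ.+ + k) ℤ.* (+ 5 ℤ.+ + k)) (a ℤ.* a)) (cong₂ ℕ._*_ (ℤP.abs-* (+ 1 ℤ.+ + k) (+ 5 ℤ.+ + k)) (ℤP.abs-* a a)) ⟩
      suc k ℕ.* (5 ℕ.+ k) ℕ.* (ℤ.∣ a ∣ ℕ.* ℤ.∣ a ∣)             ∎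

-- Counting intersections of lines.

module Incidence where
  open import Data.Fin.Subset using (_-_)
  open import Data.Nat hiding (_≟_)
  open import Data.Nat.Properties hiding (_≟_)
  open Sum +-*-semiring using (sum; sum-cong-≗; ∑-comm; ∑-distrib-+; *-distribˡ-sum; *-distribʳ-sum)

  private variable v r n m : ℕ

  sum-mono : (f g : Fin n → ℕ) → (∀ i → f i ≤ g i) → sum f ≤ sum g
  sum-mono {zero}  f g f≤g = z≤n
  sum-mono {suc n} f g f≤g = +-mono-≤ (f≤g zero) (sum-mono (f ∘ suc) (g ∘ suc) (f≤g ∘ suc))

  sum-tight : (f g : Fin n → ℕ) → (∀ i → f i ≤ g i) → sum f ≡ sum g → ∀ i → f i ≡ g i
  sum-tight {suc n} f g f≤g eq = λ { zero → f₀≡g₀ ; (suc i) → sum-tight (f ∘ suc) (g ∘ suc) (f≤g ∘ suc) (+-cancelˡ-≡ (f zero) _ _ (trans eq (cong (_+ _) (sym f₀≡g₀)))) i }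
    where
    f₀≡g₀ : f zero ≡ g zero
    f₀≡g₀ = ≤-antisym (f≤g zero) (+-cancelʳ-≤ (sum (f ∘ suc)) _ _
      (≤-trans (+-monoʳ-≤ (g zero) (sum-mono _ _ (f≤g ∘ suc))) (≤-reflexive (sym eq))))

  δ : Fin n → Fin n → ℕ
  δ zero    zero    = 1
  δ zero    (suc j) = 0
  δ (suc i) zero    = 0
  δ (suc i) (suc j) = δ i j

  δ-refl : (i : Fin n) → δ i i ≡ 1
  δ-refl zero    = refl
  δ-refl (suc i) = δ-refl i

  δ-≢ : {i j : Fin n} → i ≢ j → δ i j ≡ 0
  δ-≢ {i = zero}  {zero}  i≢j = contradiction refl i≢j
  δ-≢ {i = zero}  {suc j} i≢j = refl
  δ-≢ {i = suc i} {zero}  i≢j = refl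
  δ-≢ {i = suc i} {suc j} i≢j = δ-≢ (i≢j ∘ cong suc)

  δ-⇔ : {i j : Fin n} {k l : Fin m} → (i ≡ j → k ≡ l) → (k ≡ l → i ≡ j) → δ i j ≡ δ k l
  δ-⇔ {i = i} {j} {k} to from with i ≟ j
  ... | yes refl = trans (δ-refl i) (trans (sym (δ-refl k)) (cong (δ k) (to refl)))
  ... | no  i≢j  = trans (δ-≢ i≢j) (sym (δ-≢ (i≢j ∘ from)))

  sum-δ : (i : Fin n) → sum (δ i) ≡ 1
  sum-δ {suc n} zero = cong suc (sum-zero n)
    where
    sum-zero : ∀ n → sum {n} (λ _ → 0) ≡ 0
    sum-zero zero    = refl
    sum-zero (suc n) = sum-zero n
  sum-δ {suc n} (suc i) = sum-δ i

  indicator : Subset n → Fin n → ℕ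
  indicator S p = if lookup S p then 1 else 0

  ∣p∣≡sum : (S : Subset n) → ∣ S ∣ ≡ sum (indicator S)
  ∣p∣≡sum []          = refl
  ∣p∣≡sum (true  ∷ S) = cong suc (∣p∣≡sum S)
  ∣p∣≡sum (false ∷ S) = ∣p∣≡sum S

  indicator-∩ : (S T : Subset n) (p : Fin n) → indicator (S ∩ T) p ≡ indicator S p * indicator T p
  indicator-∩ S T p rewrite lookup-zipWith Bool._∧_ p S T with lookup S p | lookup T p
  ... | true  | true  = refl
  ... | true  | false = refl
  ... | false | _     = refl

  ∣p∩q∣≡sum : (S T : Subset n) → ∣ S ∩ T ∣ ≡ sum (λ p → indicator S p * indicator T p)
  ∣p∩q∣≡sum S T = trans (∣p∣≡sum (S ∩ T)) (sum-cong-≗ (indicator-∩ S T))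

  Empty⇒∣p∣≡0 : (S : Subset n) → Empty S → ∣ S ∣ ≡ 0
  Empty⇒∣p∣≡0 {n} S empty = trans (cong ∣_∣ (Empty-unique empty)) (∣⊥∣≡0 n)

  subsingleton⇒∣p∣≤1 : (S : Subset n) → (∀ {p q} → p ∈ S → q ∈ S → p ≡ q) → ∣ S ∣ ≤ 1
  subsingleton⇒∣p∣≤1 []          ss = z≤n
  subsingleton⇒∣p∣≤1 (true  ∷ S) ss = s≤s (≤-reflexive (Empty⇒∣p∣≡0 S λ (p , p∈S) → contradiction (ss here (there p∈S)) λ ()))
  subsingleton⇒∣p∣≤1 (false ∷ S) ss = subsingleton⇒∣p∣≤1 S λ p∈S q∈S → Fin.suc-injective (ss (there p∈S) (there q∈S))

  ∣p∣≡3⇒triple : (S : Subset n) → ∣ S ∣ ≡ 3 → ∀ {a b c x} → a ∈ S → b ∈ S → c ∈ S → x ∈ S →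
    a ≢ b → a ≢ c → b ≢ c → x ≡ a ⊎ x ≡ b ⊎ x ≡ c
  ∣p∣≡3⇒triple S ∣S∣≡3 {a} {b} {c} {x} a∈S b∈S c∈S x∈S a≢b a≢c b≢c with x ≟ a | x ≟ b | x ≟ c
  ... | yes x≡a | _       | _       = inj₁ x≡a
  ... | no  _   | yes x≡b | _       = inj₂ (inj₁ x≡b)
  ... | no  _   | no  _   | yes x≡c = inj₂ (inj₂ x≡c)
  -- Removing four distinct elements one after another lowers the cardinality each time, so it was
  -- at least 4.
  ... | no  x≢a | no  x≢b | no  x≢c = contradiction ∣S∣≡3 (>⇒≢ (≤-trans (s≤s (≤-trans (s≤s (≤-trans (s≤s (≤-trans (s≤s z≤n)
      (x∈p⇒∣p-x∣<∣p∣ x∈))) (x∈p⇒∣p-x∣<∣p∣ c∈))) (x∈p⇒∣p-x∣<∣p∣ b∈))) (x∈p⇒∣p-x∣<∣p∣ a∈S)))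
    where
    b∈ : b ∈ S - a
    b∈ = x∈p∧x≢y⇒x∈p-y b∈S (≢-sym a≢b)
    c∈ : c ∈ S - a - b
    c∈ = x∈p∧x≢y⇒x∈p-y (x∈p∧x≢y⇒x∈p-y c∈S (≢-sym a≢c)) (≢-sym b≢c)
    x∈ : x ∈ S - a - b - c
    x∈ = x∈p∧x≢y⇒x∈p-y (x∈p∧x≢y⇒x∈p-y (x∈p∧x≢y⇒x∈p-y x∈S x≢a) x≢b) x≢c

  module Intersections (C : Configuration v r) where
    open Configuration C
    open ≡-Reasoning

    ∣L∩L∣≡r : ∀ i → ∣ line i ∩ line i ∣ ≡ r
    ∣L∩L∣≡r i = trans (cong ∣_∣ (∩-idem (line i))) (points-per-line i)

    common-point-unique : ∀ {i j p q} → i ≢ j → p ∈ line i → p ∈ line j → q ∈ line i → q ∈ line j → p ≡ q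
    common-point-unique {i} {j} {p} {q} i≢j pi pj qi qj with p ≟ q
    ... | yes p≡q = p≡q
    ... | no  p≢q = contradiction (linear p q p≢q i j pi qi pj qj) i≢j

    ∣L∩M∣≤1 : ∀ {i j} → i ≢ j → ∣ line i ∩ line j ∣ ≤ 1
    ∣L∩M∣≤1 {i} {j} i≢j = subsingleton⇒∣p∣≤1 _ λ p∈ q∈ →
      let pi , pj = x∈p∩q⁻ (line i) (line j) p∈
          qi , qj = x∈p∩q⁻ (line i) (line j) q∈
      in common-point-unique i≢j pi pj qi qj

    sum-incident : ∀ p → sum (λ j → indicator (line j) p) ≡ r
    sum-incident p = begin
      sum (λ j → indicator (line j) p)     ≡⟨ sum-cong-≗ (λ j → cong (λ b → if b then 1 else 0) (lookup∘tabulate (λ i → lookup (line i) p) j)) ⟨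
      sum (indicator (linesThrough p))     ≡⟨ ∣p∣≡sum (linesThrough p) ⟨
      ∣ linesThrough p ∣                   ≡⟨ lines-per-point p ⟩
      r                                    ∎

    -- Exchanging the sums counts, for each of the r points of the line, the r lines through it.
    sum-∣L∩M∣ : ∀ i → sum (λ j → ∣ line i ∩ line j ∣) ≡ r * r
    sum-∣L∩M∣ i = begin
      sum (λ j → ∣ line i ∩ line j ∣)                                       ≡⟨ sum-cong-≗ (λ j → ∣p∩q∣≡sum (line i) (line j)) ⟩
      sum (λ j → sum λ p → indicator (line i) p * indicator (line j) p)     ≡⟨ ∑-comm (λ j p → indicator (line i) p * indicator (line j) p) ⟩
      sum (λ p → sum λ j → indicator (line i) p * indicator (line j) p)     ≡⟨ sum-cong-≗ (λ p → *-distribˡ-sum (indicator (line i) p) (λ j → indicator (line j) p)) ⟨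
      sum (λ p → indicator (line i) p * sum λ j → indicator (line j) p)     ≡⟨ sum-cong-≗ (λ p → cong (indicator (line i) p *_) (sum-incident p)) ⟩
      sum (λ p → indicator (line i) p * r)                                  ≡⟨ *-distribʳ-sum r (indicator (line i)) ⟨
      sum (indicator (line i)) * r                                          ≡⟨ cong (_* r) (trans (sym (∣p∣≡sum (line i))) (points-per-line i)) ⟩
      r * r                                                                 ∎

    parallel⇒∣L∩M∣≡0 : ∀ {i j} → Parallel i j → ∣ line i ∩ line j ∣ ≡ 0
    parallel⇒∣L∩M∣≡0 = Empty⇒∣p∣≡0 _

    -- Summed over j the two sides agree by double counting, so the pointwise
    -- inequality is an equality: σ i and ρ i are the only lines parallel to i.
    module _ (deficiency : v + r ≡ r * r + 3) {σ ρ : Fin v → Fin v}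
             (∥-σ : ∀ i → Parallel i (σ i)) (∥-ρ : ∀ i → Parallel i (ρ i))
             (i≢σi : ∀ i → i ≢ σ i) (i≢ρi : ∀ i → i ≢ ρ i) (σi≢ρi : ∀ i → σ i ≢ ρ i) where

      intersection-count : ∀ i j → ∣ line i ∩ line j ∣ + δ i j + δ (σ i) j + δ (ρ i) j ≡ 1 + r * δ i j
      intersection-count i = sum-tight _ _ bound (begin
        sum (λ j → ∣ line i ∩ line j ∣ + δ i j + δ (σ i) j + δ (ρ i) j)
          ≡⟨ trans (∑-distrib-+ (λ j → ∣ line i ∩ line j ∣ + δ i j + δ (σ i) j) (δ (ρ i)))
            (cong₂ _+_ (trans (∑-distrib-+ (λ j → ∣ line i ∩ line j ∣ + δ i j) (δ (σ i)))
              (cong₂ _+_ (trans (∑-distrib-+ (λ j → ∣ line i ∩ line j ∣) (δ i)) (cong₂ _+_ (sum-∣L∩M∣ i) (sum-δ i))) (sum-δ (σ i)))) (sum-δ (ρ i))) ⟩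
        r * r + 1 + 1 + 1          ≡⟨ trans (+-assoc (r * r + 1) 1 1) (+-assoc (r * r) 1 2) ⟩
        -- The 3 is the contribution of the line itself and of its two parallels, so deficiency 3
        -- leaves no slack in the bound.
        r * r + 3                  ≡⟨ deficiency ⟨
        v + r                      ≡⟨ cong₂ _+_ (sum-one v) (trans (cong (r *_) (sum-δ i)) (*-identityʳ r)) ⟨
        sum {v} (λ _ → 1) + r * sum (δ i) ≡⟨ cong (λ s → sum {v} (λ _ → 1) + s) (*-distribˡ-sum r (δ i)) ⟩
        sum {v} (λ _ → 1) + sum (λ j → r * δ i j) ≡⟨ ∑-distrib-+ (λ _ → 1) (λ j → r * δ i j) ⟨
        sum (λ j → 1 + r * δ i j)  ∎)
        where
        sum-one : ∀ n → sum {n} (λ _ → 1) ≡ n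
        sum-one zero    = refl
        sum-one (suc n) = cong suc (sum-one n)
        bound : ∀ j → ∣ line i ∩ line j ∣ + δ i j + δ (σ i) j + δ (ρ i) j ≤ 1 + r * δ i j
        bound j with i ≟ j | σ i ≟ j | ρ i ≟ j
        ... | yes refl | _ | _
          rewrite ∣L∩L∣≡r i | δ-refl i | δ-≢ (≢-sym (i≢σi i)) | δ-≢ (≢-sym (i≢ρi i)) | *-identityʳ r | +-identityʳ (r + 1) | +-identityʳ (r + 1) | +-comm r 1 = ≤-refl
        ... | no i≢j | yes refl | _
          rewrite parallel⇒∣L∩M∣≡0 (∥-σ i) | δ-≢ i≢j | δ-refl (σ i) | δ-≢ (≢-sym (σi≢ρi i)) = s≤s z≤n
        ... | no i≢j | no σi≢j | yes refl
          rewrite parallel⇒∣L∩M∣≡0 (∥-ρ i) | δ-≢ i≢j | δ-≢ σi≢j | δ-refl (ρ i) = s≤s z≤n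
        ... | no i≢j | no σi≢j | no ρi≢j
          rewrite δ-≢ i≢j | δ-≢ σi≢j | δ-≢ ρi≢j | *-zeroʳ r
            | +-identityʳ (∣ line i ∩ line j ∣) | +-identityʳ (∣ line i ∩ line j ∣) | +-identityʳ (∣ line i ∩ line j ∣) = ∣L∩M∣≤1 i≢j

      meet : ∀ {i j} → i ≢ j → σ i ≢ j → ρ i ≢ j → ∃[ p ] p ∈ line i × p ∈ line j
      meet {i} {j} i≢j σi≢j ρi≢j with nonempty? (line i ∩ line j)
      ... | yes (p , p∈) = p , x∈p∩q⁻ (line i) (line j) p∈
      ... | no  empty    = contradiction (intersection-count i j) λ eq → contradiction (trans (sym lhs) eq) λ ()
        where
        lhs : ∣ line i ∩ line j ∣ + δ i j + δ (σ i) j + δ (ρ i) j ≡ 0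
        lhs rewrite parallel⇒∣L∩M∣≡0 empty | δ-≢ i≢j | δ-≢ σi≢j | δ-≢ ρi≢j = refl

  -- Cyclic successor, and the permutation of the lines that a cycle partition defines.

  next-inject₁ : ∀ {n} (i : Fin n) → next (inject₁ i) ≡ suc i
  next-inject₁ {n} i = Fin.toℕ-injective (begin
    toℕ (next (inject₁ i))                ≡⟨ Fin.toℕ-fromℕ< (m%n<n (suc (toℕ (inject₁ i))) (suc n)) ⟩
    suc (toℕ (inject₁ i)) % suc n         ≡⟨ cong (λ k → suc k % suc n) (Fin.toℕ-inject₁ i) ⟩
    suc (toℕ i) % suc n                   ≡⟨ m<n⇒m%n≡m (s≤s (Fin.toℕ<n i)) ⟩
    suc (toℕ i)                           ∎)
    where open ≡-Reasoning

  next-fromℕ : ∀ n → next (fromℕ n) ≡ zero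
  next-fromℕ n = Fin.toℕ-injective (begin
    toℕ (next (fromℕ n))                  ≡⟨ Fin.toℕ-fromℕ< (m%n<n (suc (toℕ (fromℕ n))) (suc n)) ⟩
    suc (toℕ (fromℕ n)) % suc n           ≡⟨ cong (λ k → suc k % suc n) (Fin.toℕ-fromℕ n) ⟩
    suc n % suc n                         ≡⟨ n%n≡0 (suc n) ⟩
    0                                     ∎)
    where open ≡-Reasoning

  prev : ∀ {n} → Fin n → Fin n
  prev {suc n} zero    = fromℕ n
  prev {suc n} (suc i) = inject₁ i

  next-prev : ∀ {n} (i : Fin n) → next (prev i) ≡ i
  next-prev {suc n} zero    = next-fromℕ n
  next-prev {suc n} (suc i) = next-inject₁ i

  prev-next : ∀ {n} (i : Fin n) → prev (next i) ≡ i
  prev-next {suc n} i with view i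
  ... | ‵fromℕ     rewrite next-fromℕ n   = refl
  ... | ‵inject₁ j rewrite next-inject₁ j = refl

  next≢ : ∀ {n} → 3 ≤ n → (i : Fin n) → i ≢ next i
  next≢ {suc (suc n)} (s≤s (s≤s _)) i eq with view i
  ... | ‵fromℕ     = Fin.0≢1+n (sym (trans eq (next-fromℕ (suc n))))
  ... | ‵inject₁ j = 1+n≢n (trans (cong toℕ (sym (trans eq (next-inject₁ j)))) (Fin.toℕ-inject₁ j))

  next≢prev : ∀ {n} → 3 ≤ n → (i : Fin n) → next i ≢ prev i
  next≢prev {suc (suc (suc n))} (s≤s (s≤s (s≤s _))) i eq with view i
  ... | ‵fromℕ          = contradiction (trans (sym (next-fromℕ (suc (suc n)))) eq) λ ()
  ... | ‵inject₁ zero    = contradiction (trans (sym (next-inject₁ {suc (suc n)} zero)) eq) λ ()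
  ... | ‵inject₁ (suc j) = m+1+n≢m (toℕ j) (begin
    toℕ j + 2                    ≡⟨ +-comm (toℕ j) 2 ⟩
    toℕ (suc (suc j))            ≡⟨ cong toℕ (trans (sym (next-inject₁ (suc j))) eq) ⟩
    toℕ (inject₁ (inject₁ j))    ≡⟨ trans (Fin.toℕ-inject₁ (inject₁ j)) (Fin.toℕ-inject₁ j) ⟩
    toℕ j                        ∎)
    where open ≡-Reasoning

  tabulate-unique-length : ∀ {v} (is : List (Fin v)) → Unique is → (∀ i → i ∈ˡ is) → List.length is ≡ v
  tabulate-unique-length {v} is unique complete = trans
    (↭-length (∼bag⇒↭ (unique∧set⇒bag unique (Unique.allFin⁺ v) (mk⇔ (λ _ → ∈-allFin _) (λ _ → complete _)))))
    (length-tabulate {n = v} (λ i → i))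

  length-concat : ∀ {A : Set} (xss : List (List A)) → List.length (concat xss) ≡ sumˡ (map List.length xss)
  length-concat []         = refl
  length-concat (xs ∷ xss) = trans (length-++ xs) (cong (λ s → List.length xs + s) (length-concat xss))

  module Cycles {v r m} (C : Configuration v r) (P : CyclePartition C m) where
    open Configuration C
    open CyclePartition P

    private
      position : Fin v → Σ (Fin m) (Fin ∘ length)
      position i = proj₁ (proj₂ partition i)

      cycle-position : ∀ i → uncurry cycle (position i) ≡ i
      cycle-position i = proj₂ (proj₂ partition i) refl

      position-cycle : ∀ c t → position (cycle c t) ≡ (c , t)
      position-cycle c t = proj₁ partition (cycle-position (cycle c t))

    cycle-injective : ∀ {c} {s t : Fin (length c)} → cycle c s ≡ cycle c t → s ≡ t
    -- The type of the position depends on the cycle, so cancelling the equal first components needs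
    -- uniqueness of equality proofs.
    cycle-injective eq = ,-injectiveʳ-UIP (λ { refl refl → refl }) (proj₁ partition eq)

    successor predecessor : Fin v → Fin v
    successor   i = let c , t = position i in cycle c (next t)
    predecessor i = let c , t = position i in cycle c (prev t)

    successor-cycle : ∀ c t → successor (cycle c t) ≡ cycle c (next t)
    successor-cycle c t rewrite position-cycle c t = refl

    predecessor-cycle : ∀ c t → predecessor (cycle c t) ≡ cycle c (prev t)
    predecessor-cycle c t rewrite position-cycle c t = refl

    private
      -- It suffices to check a property on lines written as `cycle c t`, where successor and
      -- predecessor are given by `next` and `prev`.
      by-position : (Q : Fin v → Set) → (∀ c t → Q (cycle c t)) → ∀ i → Q i
      by-position Q q i = subst Q (cycle-position i) (uncurry q (position i))

    successor-predecessor : ∀ i → successor (predecessor i) ≡ i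
    successor-predecessor = by-position _ λ c t →
      trans (cong successor (predecessor-cycle c t)) (trans (successor-cycle c (prev t)) (cong (cycle c) (next-prev t)))

    predecessor-successor : ∀ i → predecessor (successor i) ≡ i
    predecessor-successor = by-position _ λ c t →
      trans (cong predecessor (successor-cycle c t)) (trans (predecessor-cycle c (next t)) (cong (cycle c) (prev-next t)))

    ∥-successor : ∀ i → Parallel i (successor i)
    ∥-successor = by-position _ λ c t → subst (Parallel _) (sym (successor-cycle c t)) (consecutive c t)

    ∥-sym : ∀ {i j} → Parallel i j → Parallel j i
    ∥-sym {i} {j} = subst Empty (∩-comm (line i) (line j))

    ∥-predecessor : ∀ i → Parallel i (predecessor i)
    ∥-predecessor i = ∥-sym (subst (Parallel _) (successor-predecessor i) (∥-successor (predecessor i)))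

    i≢successor : ∀ i → i ≢ successor i
    i≢successor = by-position _ λ c t eq → next≢ (length≥3 c) t (cycle-injective (trans eq (successor-cycle c t)))

    i≢predecessor : ∀ i → i ≢ predecessor i
    i≢predecessor i eq = i≢successor (predecessor i) (trans (sym eq) (sym (successor-predecessor i)))

    successor≢predecessor : ∀ i → successor i ≢ predecessor i
    successor≢predecessor = by-position _ λ c t eq → next≢prev (length≥3 c) t
      (cycle-injective (trans (sym (successor-cycle c t)) (trans eq (predecessor-cycle c t))))

    cycles : List (List (Fin v))
    cycles = List.tabulate λ c → List.tabulate (cycle c)

    lengths : List ℕ
    lengths = List.tabulate length

    map-length-cycles : map List.length cycles ≡ lengths
    map-length-cycles = trans (map-tabulate _ List.length) (tabulate-cong (λ c → length-tabulate (cycle c)))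

    cycles-unique : Unique (concat cycles)
    cycles-unique = Unique.concat⁺ (all-tabulate⁺ λ c → Unique.tabulate⁺ cycle-injective)
      (allPairs-tabulate⁺ λ c≢d (i∈c , i∈d) →
        let s , i≡s = ∈-tabulate⁻ i∈c
            t , i≡t = ∈-tabulate⁻ i∈d
        in c≢d (,-injectiveˡ (proj₁ partition (trans (sym i≡s) i≡t))))

    length-cycles : List.length (concat cycles) ≡ v
    length-cycles = tabulate-unique-length (concat cycles) cycles-unique
      (by-position _ λ c t → ∈-concat⁺′ (∈-tabulate⁺ t) (∈-tabulate⁺ c))

    sum-lengths : sumˡ lengths ≡ v
    sum-lengths = trans (cong sumˡ (sym map-length-cycles)) (trans (sym (length-concat cycles)) length-cycles)

    length-lengths : List.length lengths ≡ m
    length-lengths = length-tabulate length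

open Incidence

-- Two vector families with the same scalar products.

path-tabulate : {I : Set} {σ : I → I} {z : I} → ∀ {k} (f : Fin (suc k) → I) →
  (∀ t → σ (f (inject₁ t)) ≡ f (suc t)) → σ (f (fromℕ k)) ≡ z →
  Path σ (f zero) (List.tabulate (f ∘ suc)) z
path-tabulate {k = zero}  f step end = end
path-tabulate {k = suc k} f step end = step zero , path-tabulate (f ∘ suc) (step ∘ suc) end

module GramComparison (k : ℕ) {v r m : ℕ} (C : Configuration v r) (deficiency : v ℕ.+ r ≡ r ℕ.* r ℕ.+ 3) (r≡ : r ≡ 4 ℕ.+ k)
            (P : CyclePartition C m) where
  open Configuration C
  open CyclePartition P
  open Cycles C P
  open Intersections C
  open Irrationality k
  open QuadraticRing ν
  open Exterior ν
  open Sum K.semiring using (sum; sum-cong-≗)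
  open Exp K.semiring using (_^_)
  module ℕΣ = Sum ℕP.+-*-semiring
  open ≡-Reasoning

  embed : ℕ → Quadratic
  embed a = ⟦ + a , + 0 ⟧

  embed-* : ∀ a b → embed (a ℕ.* b) ≡ embed a * embed b
  embed-* a b = cong₂ ⟦_,_⟧ (trans (ℤP.pos-* a b) (sym (ℤP.+-identityʳ (+ a ℤ.* + b)))) (lemma (+ a) (+ b) ν)
    where
    lemma : ∀ a b ν → + 0 ≡ a ℤ.* + 0 ℤ.+ + 0 ℤ.* b ℤ.+ + 0 ℤ.* + 0 ℤ.* ν
    lemma = ℤSolver.solve-∀

  embed-sum : ∀ {n} (f : Vector ℕ n) → embed (ℕΣ.sum f) ≡ sum (embed ∘ f)
  embed-sum {zero}  f = refl
  embed-sum {suc n} f = cong (λ s → embed (f zero) + s) (embed-sum (f ∘ suc))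

  dot-comm : ∀ {n} (D u w : Vector Quadratic n) → dot D u w ≡ dot D w u
  dot-comm D u w = sum-cong-≗ λ i → solve 3 (λ d a b → d ⊗ a ⊗ b , d ⊗ b ⊗ a) refl (D i) (u i) (w i)

  dot-linearˡ : ∀ {n} (D : Vector Quadratic n) α u w z → dot D (λ i → α * u i - w i) z ≡ α * dot D u z - dot D w z
  dot-linearˡ {zero}  D α u w z = solve 1 (λ α → Κ 0# , α ⊗ Κ 0# ⊕ ⊝ Κ 0#) refl α
  dot-linearˡ {suc n} D α u w z = trans (cong (λ s → D zero * (α * u zero - w zero) * z zero + s) (dot-linearˡ (tail D) α (tail u) (tail w) (tail z)))
    (solve 7 (λ d α a b c p q → d ⊗ (α ⊗ a ⊕ ⊝ b) ⊗ c ⊕ (α ⊗ p ⊕ ⊝ q) , α ⊗ (d ⊗ a ⊗ c ⊕ p) ⊕ ⊝ (d ⊗ b ⊗ c ⊕ q)) refl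
      (D zero) α (u zero) (w zero) (z zero) _ _)

  dot-linearʳ : ∀ {n} (D : Vector Quadratic n) α u w z → dot D z (λ i → α * u i - w i) ≡ α * dot D z u - dot D z w
  dot-linearʳ D α u w z = trans (dot-comm D z _) (trans (dot-linearˡ D α u w z) (cong₂ (λ p q → α * p - q) (dot-comm D u z) (dot-comm D w z)))

  basis : ∀ {n} → Fin n → Vector Quadratic n
  basis i j = embed (δ i j)

  dot-zeroˡ : ∀ {n} (D : Vector Quadratic n) u → dot D (λ _ → 0#) u ≡ 0#
  dot-zeroˡ {zero}  D u = refl
  dot-zeroˡ {suc n} D u = trans (cong (λ s → D zero * 0# * u zero + s) (dot-zeroˡ (tail D) (tail u))) (solve 2 (λ d u → d ⊗ Κ 0# ⊗ u ⊕ Κ 0# , Κ 0#) refl (D zero) (u zero))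

  dot-basis : ∀ {n} (D : Vector Quadratic n) i j → dot D (basis i) (basis j) ≡ D i * embed (δ i j)
  dot-basis {suc n} D zero zero = begin
    D zero * 1# * 1# + dot (tail D) (λ _ → 0#) (λ _ → 0#)   ≡⟨ cong (λ s → D zero * 1# * 1# + s) (dot-zeroˡ (tail D) (λ _ → 0#)) ⟩
    D zero * 1# * 1# + 0#                                   ≡⟨ solve 1 (λ d → d ⊗ Κ 1# ⊗ Κ 1# ⊕ Κ 0# , d ⊗ Κ 1#) refl (D zero) ⟩
    D zero * 1#                                             ∎
  dot-basis {suc n} D zero (suc j) = trans (cong (λ s → D zero * 1# * 0# + s) (dot-zeroˡ (tail D) (basis j)))
      (solve 1 (λ d → d ⊗ Κ 1# ⊗ Κ 0# ⊕ Κ 0# , d ⊗ Κ 0#) refl (D zero))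
  dot-basis {suc n} D (suc i) zero = trans (dot-comm D (basis (suc i)) (basis zero)) (trans (dot-basis D zero (suc i)) (trans (K.zeroʳ (D zero)) (sym (K.zeroʳ (D (suc i))))))
  dot-basis {suc n} D (suc i) (suc j) = trans (cong (λ s → D zero * 0# * 0# + s) (dot-basis (tail D) i j))
    (solve 2 (λ d e → d ⊗ Κ 0# ⊗ Κ 0# ⊕ e , e) refl (D zero) (D (suc i) * embed (δ i j)))

  -- G collects the scalar products of the rows of the incidence matrix bordered by a column
  -- of ones, for the form −X₀² + X₁² + … + X_v², and of the vector (r, 1, …, 1),
  -- which is orthogonal to all of these rows.
  G : Fin (suc v) → Fin (suc v) → Quadratic
  G zero    zero    = 1# + 1# - ⟦ ν , + 0 ⟧
  G zero    (suc j) = 0#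
  G (suc i) zero    = 0#
  G (suc i) (suc j) = embed ∣ line i ∩ line j ∣ - 1#

  Dᵢ : Vector Quadratic (suc v)
  Dᵢ zero    = - 1#
  Dᵢ (suc _) = 1#

  incidence : Fin (suc v) → Vector Quadratic (suc v)
  incidence zero    zero    = embed r
  incidence zero    (suc p) = 1#
  incidence (suc i) zero    = 1#
  incidence (suc i) (suc p) = embed (indicator (line i) p)

  sum-ones : ∀ n → ℕΣ.sum {n} (λ _ → 1) ≡ n
  sum-ones zero    = refl
  sum-ones (suc n) = cong suc (sum-ones n)

  -- In the corner, -r² + v = 3 - r = 2 - n by the deficiency and r = n + 1. The extra row is
  -- orthogonal to a line because the border gives -r and the r points give r; between two lines the
  -- border subtracts 1.
  dot-incidence : ∀ i j → dot Dᵢ (incidence i) (incidence j) ≡ G i j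
  dot-incidence zero zero = begin
    - 1# * embed r * embed r + sum {v} (λ _ → 1# * 1# * 1#)
      ≡⟨ cong (λ s → - 1# * embed r * embed r + s) (trans (sym (embed-sum {v} (λ _ → 1))) (cong embed (sum-ones v))) ⟩
    - 1# * embed r * embed r + embed v
      ≡⟨ solve 2 (λ r v → ⊝ Κ 1# ⊗ r ⊗ r ⊕ v , v ⊕ r ⊕ ⊝ r ⊕ ⊝ (r ⊗ r)) refl (embed r) (embed v) ⟩
    embed (v ℕ.+ r) - embed r - embed r * embed r
      ≡⟨ cong (λ z → z - embed r - embed r * embed r) (trans (cong embed deficiency) (cong (λ s → s + embed 3) (embed-* r r))) ⟩
    embed r * embed r + embed 3 - embed r - embed r * embed r
      ≡⟨ cong (λ s → embed r * embed r + embed 3 - s - embed r * embed r) (cong embed (trans r≡ (ℕP.+-comm 1 (3 ℕ.+ k)))) ⟩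
    embed r * embed r + (1# + 1# + 1#) - (⟦ ν , + 0 ⟧ + 1#) - embed r * embed r
      ≡⟨ solve 2 (λ r n → r ⊗ r ⊕ (Κ 1# ⊕ Κ 1# ⊕ Κ 1#) ⊕ ⊝ (n ⊕ Κ 1#) ⊕ ⊝ (r ⊗ r) , Κ 1# ⊕ Κ 1# ⊕ ⊝ n) refl (embed r) ⟦ ν , + 0 ⟧ ⟩
    1# + 1# - ⟦ ν , + 0 ⟧ ∎
  dot-incidence zero (suc j) = begin
    - 1# * embed r * 1# + sum (λ p → 1# * 1# * embed (indicator (line j) p))
      ≡⟨ cong (λ s → - 1# * embed r * 1# + s) (trans (sum-cong-≗ λ p → solve 1 (λ a → Κ 1# ⊗ Κ 1# ⊗ a , a) refl (embed (indicator (line j) p))) (sym (embed-sum (indicator (line j))))) ⟩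
    - 1# * embed r * 1# + embed (ℕΣ.sum (indicator (line j)))
      ≡⟨ cong (λ s → - 1# * embed r * 1# + embed s) (trans (sym (∣p∣≡sum (line j))) (points-per-line j)) ⟩
    - 1# * embed r * 1# + embed r
      ≡⟨ solve 1 (λ r → ⊝ Κ 1# ⊗ r ⊗ Κ 1# ⊕ r , Κ 0#) refl (embed r) ⟩
    0# ∎
  dot-incidence (suc i) zero = trans (dot-comm Dᵢ (incidence (suc i)) (incidence zero)) (dot-incidence zero (suc i))
  dot-incidence (suc i) (suc j) = begin
    - 1# * 1# * 1# + sum (λ p → 1# * embed (indicator (line i) p) * embed (indicator (line j) p))
      ≡⟨ cong (λ s → - 1# * 1# * 1# + s) (sum-cong-≗ λ p → trans (cong (_* embed (indicator (line j) p)) (K.*-identityˡ (embed (indicator (line i) p)))) (sym (embed-* (indicator (line i) p) (indicator (line j) p)))) ⟩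
    - 1# * 1# * 1# + sum (λ p → embed (indicator (line i) p ℕ.* indicator (line j) p))
      ≡⟨ cong (λ s → - 1# * 1# * 1# + s) (trans (sym (embed-sum (λ p → indicator (line i) p ℕ.* indicator (line j) p))) (cong embed (sym (∣p∩q∣≡sum (line i) (line j))))) ⟩
    - 1# * 1# * 1# + embed ∣ line i ∩ line j ∣
      ≡⟨ solve 1 (λ a → ⊝ Κ 1# ⊗ Κ 1# ⊗ Κ 1# ⊕ a , a ⊕ ⊝ Κ 1#) refl (embed ∣ line i ∩ line j ∣) ⟩
    embed ∣ line i ∩ line j ∣ - 1# ∎

  -- The first weight reproduces the corner of `G`. The weight x̄ gives x eᵢ - e_σ(i) the norm x̄
  -- (x² + 1) = x + x̄ = ν, and consecutive edges the product -x x̄ = -1.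
  Dₑ : Vector Quadratic (suc v)
  Dₑ zero    = 1# + 1# - ⟦ ν , + 0 ⟧
  Dₑ (suc _) = x̄

  e : Fin v → Vector Quadratic (suc v)
  e i = basis (suc i)

  edges : Fin (suc v) → Vector Quadratic (suc v)
  edges zero    = basis zero
  edges (suc i) = edge x e successor i

  -- The two unmixed terms combine to (x + x̄) δ, the two mixed ones give -1 when one line follows
  -- the other; `intersection-count` turns this into the number of common points minus 1.
  dot-edges : ∀ i j → dot Dₑ (edges i) (edges j) ≡ G i j
  dot-edges zero zero = trans (dot-basis Dₑ zero zero) (K.*-identityʳ (Dₑ zero))
  dot-edges zero (suc j) = begin
    dot Dₑ (basis zero) (edges (suc j))                    ≡⟨ dot-linearʳ Dₑ x (e j) (e (successor j)) (basis zero) ⟩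
    x * dot Dₑ (basis zero) (e j) - dot Dₑ (basis zero) (e (successor j))
      ≡⟨ cong₂ (λ p q → x * p - q) (dot-basis Dₑ zero (suc j)) (dot-basis Dₑ zero (suc (successor j))) ⟩
    x * (Dₑ zero * 0#) - Dₑ zero * 0#                      ≡⟨ solve 2 (λ x d → x ⊗ (d ⊗ Κ 0#) ⊕ ⊝ (d ⊗ Κ 0#) , Κ 0#) refl x (Dₑ zero) ⟩
    0#                                                     ∎
  dot-edges (suc i) zero = trans (dot-comm Dₑ (edges (suc i)) (edges zero)) (dot-edges zero (suc i))
  dot-edges (suc i) (suc j) = begin
    dot Dₑ (edges (suc i)) (edges (suc j))
      ≡⟨ dot-linearˡ Dₑ x (e i) (e (successor i)) (edges (suc j)) ⟩
    x * dot Dₑ (e i) (edges (suc j)) - dot Dₑ (e (successor i)) (edges (suc j))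
      ≡⟨ cong₂ (λ p q → x * p - q) (dot-e-edges i) (dot-e-edges (successor i)) ⟩
    x * (x * (x̄ * a) - x̄ * b) - (x * (x̄ * c) - x̄ * embed (δ (successor i) (successor j)))
      ≡⟨ cong (λ d → x * (x * (x̄ * a) - x̄ * b) - (x * (x̄ * c) - x̄ * embed d)) (δ-⇔ {i = successor i} {successor j} {i} {j} successor-injective (cong successor)) ⟩
    x * (x * (x̄ * a) - x̄ * b) - (x * (x̄ * c) - x̄ * a)
      ≡⟨ solve 5 (λ x y a b c → x ⊗ (x ⊗ (y ⊗ a) ⊕ ⊝ (y ⊗ b)) ⊕ ⊝ (x ⊗ (y ⊗ c) ⊕ ⊝ (y ⊗ a)) , x ⊗ y ⊗ (x ⊗ a ⊕ ⊝ b ⊕ ⊝ c) ⊕ y ⊗ a) refl x x̄ a b c ⟩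
    x * x̄ * (x * a - b - c) + x̄ * a
      ≡⟨ cong (λ u → u * (x * a - b - c) + x̄ * a) xx̄≡1 ⟩
    1# * (x * a - b - c) + x̄ * a
      ≡⟨ solve 5 (λ x y a b c → Κ 1# ⊗ (x ⊗ a ⊕ ⊝ b ⊕ ⊝ c) ⊕ y ⊗ a , (x ⊕ y ⊕ Κ 1#) ⊗ a ⊕ ⊝ a ⊕ ⊝ c ⊕ ⊝ b) refl x x̄ a b c ⟩
    (x + x̄ + 1#) * a - a - c - b
      ≡⟨ cong₂ (λ u d → u * a - a - c - embed d) x+x̄+1≡r (δ-⇔ {i = i} {successor j} {predecessor i} {j} (λ { refl → predecessor-successor j }) (λ { refl → sym (successor-predecessor i) })) ⟩
    embed r * a - a - c - b′
      ≡⟨ solve 4 (λ m a b c → m ⊕ ⊝ a ⊕ ⊝ b ⊕ ⊝ c , Κ 1# ⊕ m ⊕ ⊝ a ⊕ ⊝ b ⊕ ⊝ c ⊕ ⊝ Κ 1#) refl (embed r * a) a c b′ ⟩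
    1# + embed r * a - a - c - b′ - 1#
      ≡⟨ cong (λ u → u - a - c - b′ - 1#) (trans (cong embed count) (cong (λ s → 1# + s) (embed-* r (δ i j)))) ⟨
    l + a + c + b′ - a - c - b′ - 1#
      ≡⟨ solve 4 (λ m a b c → m ⊕ a ⊕ b ⊕ c ⊕ ⊝ a ⊕ ⊝ b ⊕ ⊝ c ⊕ ⊝ Κ 1# , m ⊕ ⊝ Κ 1#) refl l a c b′ ⟩
    l - 1# ∎
    where
    a  = embed (δ i j)
    b  = embed (δ i (successor j))
    b′ = embed (δ (predecessor i) j)
    c  = embed (δ (successor i) j)
    l  = embed ∣ line i ∩ line j ∣
    count : ∣ line i ∩ line j ∣ ℕ.+ δ i j ℕ.+ δ (successor i) j ℕ.+ δ (predecessor i) j ≡ 1 ℕ.+ r ℕ.* δ i j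
    count = intersection-count deficiency ∥-successor ∥-predecessor i≢successor i≢predecessor successor≢predecessor i j
    successor-injective : ∀ {i j} → successor i ≡ successor j → i ≡ j
    successor-injective {i} {j} eq = trans (sym (predecessor-successor i)) (trans (cong predecessor eq) (predecessor-successor j))
    x+x̄+1≡r : x + x̄ + 1# ≡ embed r
    x+x̄+1≡r = cong₂ ⟦_,_⟧ (trans (lemma ν) (cong +_ (trans (ℕP.+-comm (3 ℕ.+ k) 1) (sym r≡)))) refl
      where
      lemma : ∀ ν → + 0 ℤ.+ (+ 0 ℤ.+ + 1 ℤ.* ν) ℤ.+ + 1 ≡ ν ℤ.+ + 1
      lemma = ℤSolver.solve-∀
    dot-e-edges : ∀ a → dot Dₑ (e a) (edges (suc j)) ≡ x * (x̄ * embed (δ a j)) - x̄ * embed (δ a (successor j))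
    dot-e-edges a = trans (dot-linearʳ Dₑ x (e j) (e (successor j)) (e a))
      (cong₂ (λ p q → x * p - q) (dot-basis Dₑ (suc a) (suc j)) (dot-basis Dₑ (suc a) (suc (successor j))))

  -- Listing the lines cycle by cycle makes the wedge of the edges a concatenation of cycles. Both
  -- families are wedged in this order, so no sign of a permutation arises.
  labels : List (Fin (suc v))
  labels = zero ∷ List.map suc (concat cycles)

  is-cycles : All (Cycle successor) cycles
  is-cycles = all-tabulate⁺ λ c → is-cycle (cycle c) (length≥3 c) (successor-cycle c)
    where
    is-cycle : ∀ {ℓ} (f : Fin ℓ → Fin v) → 3 ℕ.≤ ℓ → (∀ t → successor (f t) ≡ f (next t)) → Cycle successor (List.tabulate f)
    is-cycle {suc (suc (suc ℓ))} f (s≤s (s≤s (s≤s z≤n))) step = path-tabulate f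
      (λ t → trans (step (inject₁ t)) (cong f (next-inject₁ t)))
      (trans (step (fromℕ (suc (suc ℓ)))) (cong f (next-fromℕ (suc (suc ℓ)))))

  wedge-map : ∀ {I J : Set} {n} (w : J → Vector Quadratic n) (f : I → J) is y → wedge w (List.map f is) y ≡ wedge (w ∘ f) is y
  wedge-map w f []       y = refl
  wedge-map w f (i ∷ is) y = cong (w (f i) ∧_) (wedge-map w f is y)

  Π : Quadratic
  Π = cycleProduct x lengths

  wedge-edges : wedge edges labels (1Λ (suc v)) ≡ Π · wedge basis labels (1Λ (suc v))
  wedge-edges = begin
    basis zero ∧ wedge edges (List.map suc (concat cycles)) (1Λ (suc v))            ≡⟨ cong (basis zero ∧_) (wedge-map edges suc (concat cycles) _) ⟩
    basis zero ∧ wedge (edge x e successor) (concat cycles) (1Λ (suc v))            ≡⟨ cong (basis zero ∧_) (wedge-cycles x e successor cycles is-cycles _) ⟩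
    basis zero ∧ (cycleProduct x (List.map List.length cycles) · wedge e (concat cycles) (1Λ (suc v)))
      ≡⟨ ∧-· (basis zero) _ _ ⟩
    cycleProduct x (List.map List.length cycles) · basis zero ∧ wedge e (concat cycles) (1Λ (suc v))
      ≡⟨ cong₂ (λ ls y → cycleProduct x ls · basis zero ∧ y) map-length-cycles (sym (wedge-map basis suc (concat cycles) _)) ⟩
    Π · wedge basis labels (1Λ (suc v)) ∎

  form-basis : form Dₑ (wedge basis labels (1Λ (suc v))) (wedge basis labels (1Λ (suc v))) ≡ Dₑ zero * x̄ ^ v
  form-basis = begin
    form Dₑ (wedge basis labels (1Λ (suc v))) (wedge basis labels (1Λ (suc v)))
      ≡⟨ form-orthogonal Dₑ basis (λ i j → Dₑ i * embed (δ i j)) (dot-basis Dₑ) labels orthogonal ⟩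
    Dₑ zero * 1# * foldr (λ i u → Dₑ i * embed (δ i i) * u) 1# (List.map suc (concat cycles))
      ≡⟨ cong₂ _*_ (K.*-identityʳ (Dₑ zero)) (trans (powers (concat cycles)) (cong (x̄ ^_) length-cycles)) ⟩
    Dₑ zero * x̄ ^ v ∎
    where
    orthogonal : AllPairs (λ i j → Dₑ i * embed (δ i j) ≡ 0#) labels
    orthogonal = all-map⁺ (All.tabulate λ _ → K.zeroʳ (Dₑ zero))
      ∷ allPairs-map⁺ (AllPairs.map (λ {i} i≢j → trans (cong (λ d → x̄ * embed d) (δ-≢ i≢j)) (K.zeroʳ x̄)) cycles-unique)
    powers : ∀ (is : List (Fin v)) → foldr (λ i u → Dₑ i * embed (δ i i) * u) 1# (List.map suc is) ≡ x̄ ^ List.length is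
    powers []       = refl
    powers (i ∷ is) = cong₂ _*_ (trans (cong (λ d → x̄ * embed d) (δ-refl i)) (K.*-identityʳ x̄)) (powers is)

  IsInteger : Quadratic → Set
  IsInteger u = ∃[ c ] u ≡ ⟦ c , + 0 ⟧

  determinant : Quadratic
  determinant = topCoefficient (wedge incidence labels (1Λ (suc v)))

  -- The incidence rows have integer entries, although they are compared with vectors over the
  -- quadratic ring; the contradiction rests on this integrality.
  determinant-integer : IsInteger determinant
  determinant-integer = topCoefficient-closed IsInteger (_ , refl) (_ , refl) negate add multiply integral labels
    where
    negate : ∀ {u} → IsInteger u → IsInteger (- u)
    negate (a , refl) = ℤ.- a , refl
    add : ∀ {u w} → IsInteger u → IsInteger w → IsInteger (u + w)
    add (a , refl) (b , refl) = a ℤ.+ b , refl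
    multiply : ∀ {u w} → IsInteger u → IsInteger w → IsInteger (u * w)
    multiply (a , refl) (b , refl) = a ℤ.* b , cong₂ ⟦_,_⟧ (lemma₁ a b) (lemma₂ a b ν)
      where
      lemma₁ : ∀ a b → a ℤ.* b ℤ.- + 0 ℤ.* + 0 ≡ a ℤ.* b
      lemma₁ = ℤSolver.solve-∀
      lemma₂ : ∀ a b ν → a ℤ.* + 0 ℤ.+ + 0 ℤ.* b ℤ.+ + 0 ℤ.* + 0 ℤ.* ν ≡ + 0
      lemma₂ = ℤSolver.solve-∀
    integral : ∀ i j → IsInteger (incidence i j)
    integral zero    zero    = _ , refl
    integral zero    (suc j) = _ , refl
    integral (suc i) zero    = _ , refl
    integral (suc i) (suc j) = _ , refl

  form-incidence : form Dᵢ (wedge incidence labels (1Λ (suc v))) (wedge incidence labels (1Λ (suc v))) ≡ - 1# * (determinant * determinant)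
  form-incidence = begin
    form Dᵢ W W                                           ≡⟨ form-top (suc v) Dᵢ W (subst (λ n → Homogeneous (suc v) n W) length-labels (homogeneous-wedge incidence labels)) ⟩
    - 1# * discriminant (tail Dᵢ) * (determinant * determinant) ≡⟨ cong (λ d → - 1# * d * (determinant * determinant)) (discriminant-ones v) ⟩
    - 1# * 1# * (determinant * determinant)               ≡⟨ cong (_* (determinant * determinant)) (K.*-identityʳ (- 1#)) ⟩
    - 1# * (determinant * determinant)                    ∎
    where
    W = wedge incidence labels (1Λ (suc v))
    length-labels : List.length labels ≡ suc v
    length-labels = cong suc (trans (length-map suc (concat cycles)) length-cycles)
    discriminant-ones : ∀ n → discriminant {n} (λ _ → 1#) ≡ 1#
    discriminant-ones zero    = refl
    discriminant-ones (suc n) = trans (K.*-identityˡ _) (discriminant-ones n)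

  -- Both squares evaluate the same `gram G labels labels`. The discriminant -1 of the bordered form
  -- turns the corner 2 - ν into ν - 2, which is 1 + k.
  determinant² : determinant * determinant ≡ ⟦ + (1 ℕ.+ k) , + 0 ⟧ * (x̄ ^ v * (Π * Π))
  determinant² = begin
    d * d                                             ≡⟨ solve 1 (λ d → d ⊗ d , ⊝ (⊝ Κ 1# ⊗ (d ⊗ d))) refl d ⟩
    - (- 1# * (d * d))                                ≡⟨ cong -_ form-incidence ⟨
    - form Dᵢ (wedge incidence labels (1Λ (suc v))) (wedge incidence labels (1Λ (suc v)))
      ≡⟨ cong -_ (trans (form-wedge Dᵢ incidence G dot-incidence labels labels) (sym (form-wedge Dₑ edges G dot-edges labels labels))) ⟩
    - form Dₑ (wedge edges labels (1Λ (suc v))) (wedge edges labels (1Λ (suc v)))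
      ≡⟨ cong (λ y → - form Dₑ y y) wedge-edges ⟩
    - form Dₑ (Π · B) (Π · B)                         ≡⟨ cong -_ (trans (form-·ˡ Dₑ Π B (Π · B)) (cong (Π *_) (form-·ʳ Dₑ Π B B))) ⟩
    - (Π * (Π * form Dₑ B B))                         ≡⟨ cong (λ y → - (Π * (Π * y))) form-basis ⟩
    - (Π * (Π * ((1# + 1# - ⟦ ν , + 0 ⟧) * x̄ ^ v)))   ≡⟨ solve 3 (λ p n y → ⊝ (p ⊗ (p ⊗ ((Κ 1# ⊕ Κ 1# ⊕ ⊝ n) ⊗ y))) , (n ⊕ ⊝ Κ 1# ⊕ ⊝ Κ 1#) ⊗ (y ⊗ (p ⊗ p))) refl Π ⟦ ν , + 0 ⟧ (x̄ ^ v) ⟩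
    (⟦ ν , + 0 ⟧ - 1# - 1#) * (x̄ ^ v * (Π * Π))       ∎
    where
    d = determinant
    B = wedge basis labels (1Λ (suc v))

  m-not-even : ∀ h t → v ≡ suc (h ℕ.+ h) → m ≢ 2 ℕ.* t
  m-not-even h t v≡ m≡ = let c , d≡c = determinant-integer in
    no-even-cycleProduct lengths lengths-nonZero h t (trans sum-lengths v≡) (trans length-lengths m≡) c
      (trans (sym (cong₂ _*_ d≡c d≡c)) (trans determinant² (cong (λ n → ⟦ + (1 ℕ.+ k) , + 0 ⟧ * (x̄ ^ n * (Π * Π))) (sym sum-lengths))))
    where
    lengths-nonZero : All NonZero lengths
    lengths-nonZero = all-tabulate⁺ λ c → ℕ.>-nonZero (ℕP.<-≤-trans (s≤s z≤n) (length≥3 c))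

-- Configurations with nine points and two cycles.

injective⇒surjective : ∀ {n} {f : Fin n → Fin n} → Injective _≡_ _≡_ f → ∀ y → ∃[ x ] f x ≡ y
injective⇒surjective {suc n} {f} f-injective y with any? (λ x → f x ≟ y)
... | yes surjective = surjective
... | no  missed     = contradiction (Fin.injective⇒≤ punched-injective) ℕP.1+n≰n
  where
  y≢f : ∀ x → y ≢ f x
  y≢f x y≡fx = missed (x , sym y≡fx)
  punched : Fin (suc n) → Fin n
  punched x = punchOut (y≢f x)
  punched-injective : Injective _≡_ _≡_ punched
  punched-injective {x} {x′} eq = f-injective (Fin.punchOut-injective (y≢f x) (y≢f x′) eq)

-- The given map becomes the backward direction, because `image` looks points up through
-- `Inverse.from`.
injective⇒↔ : ∀ {n} {f : Fin n → Fin n} → Injective _≡_ _≡_ f → Fin n ↔ Fin n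
injective⇒↔ {f = f} f-injective = mk↔ₛ′ (proj₁ ∘ surjective) f (λ y → f-injective (proj₂ (surjective (f y)))) (proj₂ ∘ surjective)
  where surjective = injective⇒surjective f-injective

third-unique : {x y z u : Fin 3} → x ≢ y → x ≢ z → y ≢ z → u ≢ x → u ≢ y → u ≡ z
third-unique {x} {y} {z} {u} = toWitness
  {a? = all? λ x → all? λ y → all? λ z → all? λ u →
    ¬? (x ≟ y) →-dec (¬? (x ≟ z) →-dec (¬? (y ≟ z) →-dec (¬? (u ≟ x) →-dec (¬? (u ≟ y) →-dec (u ≟ z)))))} _ x y z u

module NineThree (C : Configuration 9 3) where
  open Configuration C
  open Intersections C

  points-triple : ∀ {i p q s x} → p ∈ line i → q ∈ line i → s ∈ line i → x ∈ line i →
    p ≢ q → p ≢ s → q ≢ s → x ≡ p ⊎ x ≡ q ⊎ x ≡ s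
  points-triple {i} = ∣p∣≡3⇒triple (line i) (points-per-line i)

  lines-triple : ∀ {p i j k l} → p ∈ line i → p ∈ line j → p ∈ line k → p ∈ line l →
    i ≢ j → i ≢ k → j ≢ k → l ≡ i ⊎ l ≡ j ⊎ l ≡ k
  lines-triple {p} pi pj pk pl = ∣p∣≡3⇒triple (linesThrough p) (lines-per-point p) (through pi) (through pj) (through pk) (through pl)
    where
    through : ∀ {i} → p ∈ line i → i ∈ linesThrough p
    through {i} p∈ = lookup⇒[]= i (linesThrough p) (trans (lookup∘tabulate (λ i → lookup (line i) p) i) ([]=⇒lookup p∈))

  not-concurrent : ∀ {p i j k l} → p ∈ line i → p ∈ line j → p ∈ line k → p ∈ line l →
    i ≢ j → i ≢ k → j ≢ k → l ≢ i → l ≢ j → l ≢ k → ⊥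
  not-concurrent pi pj pk pl i≢j i≢k j≢k l≢i l≢j l≢k =
    [ l≢i , [ l≢j , l≢k ]′ ]′ (lines-triple pi pj pk pl i≢j i≢k j≢k)

  parallel-≢ : ∀ {i j p q} → Parallel i j → p ∈ line i → q ∈ line j → p ≢ q
  parallel-≢ i∥j p∈i p∈j refl = i∥j (_ , x∈p∩q⁺ (p∈i , p∈j))

  Meet : Fin 9 → Fin 9 → Set
  Meet i j = ∃[ p ] p ∈ line i × p ∈ line j

  -- Every further line meets the quadrilateral b in four points, hence passes
  -- through b₀ ∩ b₂ or b₁ ∩ b₃; there is room for only two such lines.
  no-quadrilateral : (b : Fin 4 → Fin 9) (d : Fin 3 → Fin 9) → Injective _≡_ _≡_ b → Injective _≡_ _≡_ d →
    (∀ s t → b s ≢ d t) → (∀ s → Parallel (b s) (b (next s))) → (∀ s t → Meet (d t) (b s)) →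
    Meet (b 0F) (b 2F) → Meet (b 1F) (b 3F) → ⊥
  no-quadrilateral b d b-injective d-injective b≢d b∥b meet-db (P , P∈b₀ , P∈b₂) (Q , Q∈b₁ , Q∈b₃) =
    impossible (through 0F) (through 1F) (through 2F)
    where
    through : ∀ t → P ∈ line (d t) ⊎ Q ∈ line (d t)
    through t with meet-db 0F t | meet-db 1F t | meet-db 2F t | meet-db 3F t
    ... | p₀ , p₀∈d , p₀∈b | p₁ , p₁∈d , p₁∈b | p₂ , p₂∈d , p₂∈b | p₃ , p₃∈d , p₃∈b with p₀ ≟ p₂
    ... | yes refl = inj₁ (subst (_∈ line (d t)) (common-point-unique (λ eq → case b-injective {0F} {2F} eq of λ ()) p₀∈b p₂∈b P∈b₀ P∈b₂) p₀∈d)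
    -- Now p₀, p₁, p₂ are all the points of the line; p₃ differs from p₀ and p₂ by parallelism, so
    -- it is p₁, which is then b₁ ∩ b₃.
    ... | no p₀≢p₂ with points-triple p₀∈d p₁∈d p₂∈d p₃∈d (parallel-≢ (b∥b 0F) p₀∈b p₁∈b) p₀≢p₂ (parallel-≢ (b∥b 1F) p₁∈b p₂∈b)
    ... | inj₁ p₃≡p₀        = contradiction p₃≡p₀ (parallel-≢ (b∥b 3F) p₃∈b p₀∈b)
    ... | inj₂ (inj₂ p₃≡p₂) = contradiction (sym p₃≡p₂) (parallel-≢ (b∥b 2F) p₂∈b p₃∈b)
    ... | inj₂ (inj₁ refl)  = inj₂ (subst (_∈ line (d t)) (common-point-unique (λ eq → case b-injective {1F} {3F} eq of λ ()) p₁∈b p₃∈b Q∈b₁ Q∈b₃) p₁∈d)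

    same-P : ∀ {s t} → s ≢ t → P ∈ line (d s) → P ∈ line (d t) → ⊥
    same-P s≢t P∈s P∈t = not-concurrent P∈b₀ P∈b₂ P∈s P∈t
      (λ eq → case b-injective {0F} {2F} eq of λ ()) (b≢d _ _) (b≢d _ _) (≢-sym (b≢d _ _)) (≢-sym (b≢d _ _)) (λ eq → s≢t (sym (d-injective eq)))

    same-Q : ∀ {s t} → s ≢ t → Q ∈ line (d s) → Q ∈ line (d t) → ⊥
    same-Q s≢t Q∈s Q∈t = not-concurrent Q∈b₁ Q∈b₃ Q∈s Q∈t
      (λ eq → case b-injective {1F} {3F} eq of λ ()) (b≢d _ _) (b≢d _ _) (≢-sym (b≢d _ _)) (≢-sym (b≢d _ _)) (λ eq → s≢t (sym (d-injective eq)))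

    impossible : P ∈ line (d 0F) ⊎ Q ∈ line (d 0F) → P ∈ line (d 1F) ⊎ Q ∈ line (d 1F) → P ∈ line (d 2F) ⊎ Q ∈ line (d 2F) → ⊥
    impossible (inj₁ x) (inj₁ y) _        = same-P {0F} {1F} (λ ()) x y
    impossible (inj₂ x) (inj₂ y) _        = same-Q {0F} {1F} (λ ()) x y
    impossible (inj₁ x) (inj₂ y) (inj₁ z) = same-P {0F} {2F} (λ ()) x z
    impossible (inj₁ x) (inj₂ y) (inj₂ z) = same-Q {1F} {2F} (λ ()) y z
    impossible (inj₂ x) (inj₁ y) (inj₁ z) = same-P {1F} {2F} (λ ()) y z
    impossible (inj₂ x) (inj₁ y) (inj₂ z) = same-Q {0F} {2F} (λ ()) x z

  -- The points are the intersections of non-consecutive sides of the hexagon b.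
  -- Each lies on one side of the triangle a, and this colours the nine chords so
  -- that chords with a common end get distinct colours; only one such colouring
  -- exists up to renaming the colours, and it is that of configuration 9.1.
  module Hexagon (a : Fin 3 → Fin 9) (b : Fin 6 → Fin 9) (a-injective : Injective _≡_ _≡_ a) (b-injective : Injective _≡_ _≡_ b)
    (a≢b : ∀ s t → a s ≢ b t) (a∥a : ∀ {s t} → s ≢ t → Parallel (a s) (a t)) (meet-ba : ∀ s t → Meet (b t) (a s))
    (meet-bb : ∀ s t → s ≢ t → next s ≢ t → prev s ≢ t → Meet (b s) (b t)) where

    abstract
      -- The three sides of the triangle are mutually parallel, so a line of the hexagon meets them
      -- in three different points, which are all its points.
      colour : ∀ {t p} → p ∈ line (b t) → ∃[ s ] p ∈ line (a s)
      colour {t} p∈b with meet-ba 0F t | meet-ba 1F t | meet-ba 2F t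
      ... | p₀ , p₀∈b , p₀∈a | p₁ , p₁∈b , p₁∈a | p₂ , p₂∈b , p₂∈a
        with points-triple p₀∈b p₁∈b p₂∈b p∈b
               (parallel-≢ (a∥a {0F} {1F} λ ()) p₀∈a p₁∈a) (parallel-≢ (a∥a {0F} {2F} λ ()) p₀∈a p₂∈a) (parallel-≢ (a∥a {1F} {2F} λ ()) p₁∈a p₂∈a)
      ... | inj₁ refl        = 0F , p₀∈a
      ... | inj₂ (inj₁ refl) = 1F , p₁∈a
      ... | inj₂ (inj₂ refl) = 2F , p₂∈a

    end₁ end₂ : Fin 9 → Fin 6
    end₁ = Vec.lookup (0F ∷ 1F ∷ 3F ∷ 0F ∷ 2F ∷ 1F ∷ 0F ∷ 2F ∷ 1F ∷ [])
    end₂ = Vec.lookup (2F ∷ 4F ∷ 5F ∷ 4F ∷ 5F ∷ 3F ∷ 3F ∷ 4F ∷ 5F ∷ [])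

    abstract
      ends-meet : ∀ q → Meet (b (end₁ q)) (b (end₂ q))
      ends-meet q = let s≢t , ns≢t , ps≢t = far q in meet-bb (end₁ q) (end₂ q) s≢t ns≢t ps≢t
        where
        far : ∀ q → end₁ q ≢ end₂ q × next (end₁ q) ≢ end₂ q × prev (end₁ q) ≢ end₂ q
        far = toWitness {a? = all? λ q → ¬? (end₁ q ≟ end₂ q) ×-dec (¬? (next (end₁ q) ≟ end₂ q) ×-dec ¬? (prev (end₁ q) ≟ end₂ q))} _

    point : Fin 9 → Fin 9
    point q = proj₁ (ends-meet q)

    point∈end₁ : ∀ q → point q ∈ line (b (end₁ q))
    point∈end₁ q = proj₁ (proj₂ (ends-meet q))

    point∈end₂ : ∀ q → point q ∈ line (b (end₂ q))
    point∈end₂ q = proj₂ (proj₂ (ends-meet q))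

    κ : Fin 9 → Fin 3
    κ q = proj₁ (colour (point∈end₁ q))

    point∈κ : ∀ q → point q ∈ line (a (κ q))
    point∈κ q = proj₂ (colour (point∈end₁ q))

    Chord : Fin 9 → Fin 6 → Fin 6 → Set
    Chord q s t = (end₁ q ≡ s × end₂ q ≡ t) ⊎ (end₁ q ≡ t × end₂ q ≡ s)

    point∈chord : ∀ q {s t} → Chord q s t → point q ∈ line (b s) × point q ∈ line (b t)
    point∈chord q (inj₁ (refl , refl)) = point∈end₁ q , point∈end₂ q
    point∈chord q (inj₂ (refl , refl)) = point∈end₂ q , point∈end₁ q

    Adjacent : Fin 9 → Fin 9 → Fin 6 → Fin 6 → Fin 6 → Set
    Adjacent q q′ s t t′ = Chord q s t × Chord q′ s t′ × s ≢ t × s ≢ t′ × t ≢ t′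

    adjacent? : ∀ q q′ s t t′ → Dec (Adjacent q q′ s t t′)
    adjacent? q q′ s t t′ = chord? q s t ×-dec chord? q′ s t′ ×-dec ¬? (s ≟ t) ×-dec ¬? (s ≟ t′) ×-dec ¬? (t ≟ t′)
      where
      chord? : ∀ q s t → Dec (Chord q s t)
      chord? q s t = (end₁ q ≟ s ×-dec end₂ q ≟ t) ⊎-dec (end₁ q ≟ t ×-dec end₂ q ≟ s)

    -- With equal colours both points would be the intersection of b s with the same side of the
    -- triangle. They would coincide, and four lines would pass through one point.
    adjacent⇒κ≢ : ∀ q q′ {s t t′} → Adjacent q q′ s t t′ → κ q ≢ κ q′
    adjacent⇒κ≢ q q′ {s} {t} {t′} (qst , q′st′ , s≢t , s≢t′ , t≢t′) κ≡ = not-concurrent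
      q∈s q∈t (subst (_∈ line (b t′)) (sym same) q′∈t′) (point∈κ q)
      (s≢t ∘ b-injective) (s≢t′ ∘ b-injective) (t≢t′ ∘ b-injective) (a≢b _ _) (a≢b _ _) (a≢b _ _)
      where
      q∈s = proj₁ (point∈chord q qst)
      q∈t = proj₂ (point∈chord q qst)
      q′∈t′ = proj₂ (point∈chord q′ q′st′)
      same : point q ≡ point q′
      same = common-point-unique (≢-sym (a≢b (κ q) s)) q∈s (point∈κ q) (proj₁ (point∈chord q′ q′st′))
        (subst (λ k → point q′ ∈ line (a k)) (sym κ≡) (point∈κ q′))

    proper : ∀ q q′ s t t′ → {_ : True (adjacent? q q′ s t t′)} → κ q ≢ κ q′
    proper q q′ s t t′ {adjacent} = adjacent⇒κ≢ q q′ (toWitness adjacent)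

    -- The chords 02, 04, 24 (points 0, 3, 7) form a triangle and show all three colours, and so do
    -- 35, 13, 15 (points 2, 5, 8). Each long diagonal 14, 25, 03 (points 1, 4, 6) shares ends with
    -- two chords of either triangle, hence has the colour of the third.
    κ₀≢κ₃ : κ 0F ≢ κ 3F
    κ₀≢κ₃ = proper 0F 3F 0F 2F 4F
    κ₀≢κ₇ : κ 0F ≢ κ 7F
    κ₀≢κ₇ = proper 0F 7F 2F 0F 4F
    κ₃≢κ₇ : κ 3F ≢ κ 7F
    κ₃≢κ₇ = proper 3F 7F 4F 0F 2F
    κ₂≢κ₅ : κ 2F ≢ κ 5F
    κ₂≢κ₅ = proper 2F 5F 3F 5F 1F
    κ₂≢κ₈ : κ 2F ≢ κ 8F
    κ₂≢κ₈ = proper 2F 8F 5F 3F 1F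
    κ₅≢κ₈ : κ 5F ≢ κ 8F
    κ₅≢κ₈ = proper 5F 8F 1F 3F 5F

    κ₁≡κ₀ : κ 1F ≡ κ 0F
    κ₁≡κ₀ = third-unique κ₃≢κ₇ (≢-sym κ₀≢κ₃) (≢-sym κ₀≢κ₇) (proper 1F 3F 4F 1F 0F) (proper 1F 7F 4F 1F 2F)
    κ₂≡κ₁ : κ 2F ≡ κ 1F
    κ₂≡κ₁ = sym (third-unique κ₅≢κ₈ (≢-sym κ₂≢κ₅) (≢-sym κ₂≢κ₈) (proper 1F 5F 1F 4F 3F) (proper 1F 8F 1F 4F 5F))
    κ₄≡κ₃ : κ 4F ≡ κ 3F
    κ₄≡κ₃ = third-unique κ₀≢κ₇ κ₀≢κ₃ (≢-sym κ₃≢κ₇) (proper 4F 0F 2F 5F 0F) (proper 4F 7F 2F 5F 4F)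
    κ₅≡κ₄ : κ 5F ≡ κ 4F
    κ₅≡κ₄ = sym (third-unique κ₂≢κ₈ κ₂≢κ₅ (≢-sym κ₅≢κ₈) (proper 4F 2F 5F 2F 3F) (proper 4F 8F 5F 2F 1F))
    κ₆≡κ₇ : κ 6F ≡ κ 7F
    κ₆≡κ₇ = third-unique κ₀≢κ₃ κ₀≢κ₇ κ₃≢κ₇ (proper 6F 0F 0F 3F 2F) (proper 6F 3F 0F 3F 4F)
    κ₆≡κ₈ : κ 6F ≡ κ 8F
    κ₆≡κ₈ = third-unique κ₂≢κ₅ κ₂≢κ₈ κ₅≢κ₈ (proper 6F 2F 3F 0F 5F) (proper 6F 5F 3F 0F 1F)

    side : Fin 9 → Fin 3 ⊎ Fin 6
    side = Vec.lookup (inj₁ 0F ∷ inj₁ 1F ∷ inj₁ 2F ∷ inj₂ 0F ∷ inj₂ 2F ∷ inj₂ 4F ∷ inj₂ 1F ∷ inj₂ 5F ∷ inj₂ 3F ∷ [])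

    side-injective : Injective _≡_ _≡_ side
    side-injective {i} {j} = toWitness {a? = all? λ i → all? λ j → ⊎-≡-dec _≟_ _≟_ (side i) (side j) →-dec (i ≟ j)} _ i j

    π : Fin 3 → Fin 3
    π 0F = κ 0F
    π 1F = κ 3F
    π 2F = κ 7F

    π-injective : Injective _≡_ _≡_ π
    π-injective {0F} {0F} eq = refl
    π-injective {0F} {1F} eq = contradiction eq κ₀≢κ₃
    π-injective {0F} {2F} eq = contradiction eq κ₀≢κ₇
    π-injective {1F} {0F} eq = contradiction (sym eq) κ₀≢κ₃
    π-injective {1F} {1F} eq = refl
    π-injective {1F} {2F} eq = contradiction eq κ₃≢κ₇
    π-injective {2F} {0F} eq = contradiction (sym eq) κ₀≢κ₇
    π-injective {2F} {1F} eq = contradiction (sym eq) κ₃≢κ₇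
    π-injective {2F} {2F} eq = refl

    lineOf : Fin 3 ⊎ Fin 6 → Fin 9
    lineOf = [ a ∘ π , b ]′

    lineOf-injective : Injective _≡_ _≡_ lineOf
    lineOf-injective {inj₁ s} {inj₁ t} eq = cong inj₁ (π-injective (a-injective eq))
    lineOf-injective {inj₁ s} {inj₂ t} eq = contradiction eq (a≢b (π s) t)
    lineOf-injective {inj₂ s} {inj₁ t} eq = contradiction (sym eq) (a≢b (π t) s)
    lineOf-injective {inj₂ s} {inj₂ t} eq = cong inj₂ (b-injective eq)

    Λ : Fin 9 → Fin 9
    Λ = lineOf ∘ side

    Λ-injective : Injective _≡_ _≡_ Λ
    Λ-injective = side-injective ∘ lineOf-injective

    sideA : Fin 9 → Fin 3
    sideA = Vec.lookup (0F ∷ 0F ∷ 0F ∷ 1F ∷ 1F ∷ 1F ∷ 2F ∷ 2F ∷ 2F ∷ [])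

    κ≡π : ∀ q → κ q ≡ π (sideA q)
    κ≡π 0F = refl
    κ≡π 1F = κ₁≡κ₀
    κ≡π 2F = trans κ₂≡κ₁ κ₁≡κ₀
    κ≡π 3F = refl
    κ≡π 4F = κ₄≡κ₃
    κ≡π 5F = trans κ₅≡κ₄ κ₄≡κ₃
    κ≡π 6F = κ₆≡κ₇
    κ≡π 7F = refl
    κ≡π 8F = trans (sym κ₆≡κ₈) κ₆≡κ₇

    Through : Fin 9 → Fin 3 ⊎ Fin 6 → Set
    Through q ℓ = ℓ ≡ inj₂ (end₁ q) ⊎ ℓ ≡ inj₂ (end₂ q) ⊎ ℓ ≡ inj₁ (sideA q)

    through? : ∀ q ℓ → Dec (Through q ℓ)
    through? q ℓ = (ℓ ≟ₛ inj₂ (end₁ q)) ⊎-dec ((ℓ ≟ₛ inj₂ (end₂ q)) ⊎-dec (ℓ ≟ₛ inj₁ (sideA q)))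
      where _≟ₛ_ = ⊎-≡-dec _≟_ _≟_

    ∈9·1⇒through : ∀ q j → q ∈ line9·1 j → Through q (side j)
    ∈9·1⇒through = toWitness {a? = all? λ q → all? λ j → (q ∈? line9·1 j) →-dec through? q (side j)} _

    through⇒∈9·1 : ∀ q j → Through q (side j) → q ∈ line9·1 j
    through⇒∈9·1 = toWitness {a? = all? λ q → all? λ j → through? q (side j) →-dec (q ∈? line9·1 j)} _

    point∈sideA : ∀ q → point q ∈ line (a (π (sideA q)))
    point∈sideA q = subst (λ k → point q ∈ line (a k)) (κ≡π q) (point∈κ q)

    incident⁺ : ∀ q ℓ → Through q ℓ → point q ∈ line (lineOf ℓ)
    incident⁺ q _ (inj₁ refl)        = point∈end₁ q
    incident⁺ q _ (inj₂ (inj₁ refl)) = point∈end₂ q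
    incident⁺ q _ (inj₂ (inj₂ refl)) = point∈sideA q

    incident⁻ : ∀ q ℓ → point q ∈ line (lineOf ℓ) → Through q ℓ
    incident⁻ q ℓ p∈ℓ = Sum⊎.map lineOf-injective (Sum⊎.map lineOf-injective lineOf-injective)
      (lines-triple (point∈end₁ q) (point∈end₂ q) (point∈sideA q) p∈ℓ
        (ends-distinct q ∘ b-injective) (≢-sym (a≢b _ _)) (≢-sym (a≢b _ _)))
      where
      ends-distinct : ∀ q → end₁ q ≢ end₂ q
      ends-distinct = toWitness {a? = all? λ q → ¬? (end₁ q ≟ end₂ q)} _

    incidence-preserved : ∀ q j → lookup (line (Λ j)) (point q) ≡ lookup (line9·1 j) q
    incidence-preserved q j = ∈-⇔ (through⇒∈9·1 q j ∘ incident⁻ q (side j)) (incident⁺ q (side j) ∘ ∈9·1⇒through q j)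
      where
      ∈-⇔ : ∀ {m n} {S : Subset m} {T : Subset n} {p q} → (p ∈ S → q ∈ T) → (q ∈ T → p ∈ S) → lookup S p ≡ lookup T q
      ∈-⇔ {S = S} {T} {p} {q} to from with lookup S p in eq | lookup T q in eq′
      ... | true  | true  = refl
      ... | false | false = refl
      ... | true  | false = trans (sym ([]=⇒lookup (to (lookup⇒[]= p S eq)))) eq′
      ... | false | true  = trans (sym eq) ([]=⇒lookup (from (lookup⇒[]= q T eq′)))

    -- Points of configuration 9.1 are separated by the lines through them, so preserving incidence
    -- already forces injectivity.
    point-injective : Injective _≡_ _≡_ point
    point-injective {q} {q′} eq = separated q q′ λ j →
      trans (sym (incidence-preserved q j)) (trans (cong (lookup (line (Λ j))) eq) (incidence-preserved q′ j))
      where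
      separated : ∀ q q′ → (∀ j → lookup (line9·1 j) q ≡ lookup (line9·1 j) q′) → q ≡ q′
      separated = toWitness {a? = all? λ q → all? λ q′ → (all? λ j → lookup (line9·1 j) q Bool.≟ lookup (line9·1 j) q′) →-dec (q ≟ q′)} _

    bijection : Fin 9 ↔ Fin 9
    bijection = injective⇒↔ point-injective

    image-line : ∀ j → image bijection (line (Λ j)) ≡ line9·1 j
    image-line j = trans (Vec.tabulate-cong λ q → incidence-preserved q j) (tabulate∘lookup (line9·1 j))

    isomorphic : Isomorphic C configuration9·1
    isomorphic = bijection , onto , λ j → Λ j , image-line j
      where
      onto : ∀ i → ∃[ j ] image bijection (line i) ≡ line9·1 j
      onto i = let j , Λj≡i = injective⇒surjective Λ-injective i in
        j , subst (λ i → image bijection (line i) ≡ line9·1 j) Λj≡i (image-line j)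

-- Parity, the possible cycle lengths, and the distinction by n.

open import Data.Nat hiding (_≟_)
open import Data.Nat.Properties hiding (_≟_)

odd-or-even : ∀ m → (∃[ k ] m ≡ 2 * k + 1) ⊎ (∃[ k ] m ≡ 2 * k)
odd-or-even zero = inj₂ (0 , refl)
odd-or-even (suc m) with odd-or-even m
... | inj₁ (k , refl) = inj₂ (suc k , lemma k)
  where
  lemma : ∀ k → suc (2 * k + 1) ≡ 2 * suc k
  lemma = ℕSolver.solve-∀
... | inj₂ (k , refl) = inj₁ (k , +-comm 1 (2 * k))

deficiency : ∀ n → n ^ 2 + n + 3 + (n + 1) ≡ (n + 1) * (n + 1) + 3
deficiency = identity
  where
  identity : ∀ n → n * (n * 1) + n + 3 + (n + 1) ≡ (n + 1) * (n + 1) + 3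
  identity = ℕSolver.solve-∀

n²+n+3-odd : ∀ n → ∃[ h ] n ^ 2 + n + 3 ≡ suc (h + h)
n²+n+3-odd zero    = 1 , refl
n²+n+3-odd (suc n) = let h , eq = n²+n+3-odd n in suc n + h , (begin
  suc n ^ 2 + suc n + 3              ≡⟨ lemma₁ n ⟩
  2 * suc n + (n ^ 2 + n + 3)        ≡⟨ cong (λ s → 2 * suc n + s) eq ⟩
  2 * suc n + suc (h + h)            ≡⟨ lemma₂ n h ⟩
  suc (suc n + h + (suc n + h))      ∎)
  where
  open ≡-Reasoning
  lemma₁ : ∀ n → suc n * (suc n * 1) + suc n + 3 ≡ 2 * suc n + (n * (n * 1) + n + 3)
  lemma₁ = ℕSolver.solve-∀
  lemma₂ : ∀ n h → 2 * suc n + suc (h + h) ≡ suc (suc n + h + (suc n + h))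
  lemma₂ = ℕSolver.solve-∀

sum-tabulate-≥ : ∀ {k m} (f : Fin m → ℕ) → (∀ i → k ≤ f i) → m * k ≤ sumˡ (List.tabulate f)
sum-tabulate-≥ {m = zero}  f k≤f = z≤n
sum-tabulate-≥ {m = suc m} f k≤f = +-mono-≤ (k≤f zero) (sum-tabulate-≥ (f ∘ suc) (k≤f ∘ suc))

split-9 : ∀ a b → 3 ≤ a → 3 ≤ b → a + (b + 0) ≡ 9 →
  (a ≡ 3 × b ≡ 6) ⊎ (a ≡ 4 × b ≡ 5) ⊎ (a ≡ 5 × b ≡ 4) ⊎ (a ≡ 6 × b ≡ 3)
split-9 3 b 3≤a 3≤b eq = inj₁ (refl , trans (sym (+-identityʳ b)) (+-cancelˡ-≡ 3 _ _ eq))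
split-9 4 b 3≤a 3≤b eq = inj₂ (inj₁ (refl , trans (sym (+-identityʳ b)) (+-cancelˡ-≡ 4 _ _ eq)))
split-9 5 b 3≤a 3≤b eq = inj₂ (inj₂ (inj₁ (refl , trans (sym (+-identityʳ b)) (+-cancelˡ-≡ 5 _ _ eq))))
split-9 6 b 3≤a 3≤b eq = inj₂ (inj₂ (inj₂ (refl , trans (sym (+-identityʳ b)) (+-cancelˡ-≡ 6 _ _ eq))))
split-9 (suc (suc (suc (suc (suc (suc (suc a))))))) b 3≤a 3≤b eq = contradiction eq
  (>⇒≢ (+-mono-≤ (m≤m+n 7 a) (≤-trans 3≤b (m≤m+n b 0))))
split-9 1 b (s≤s ()) 3≤b eq
split-9 2 b (s≤s (s≤s ())) 3≤b eq

module TwoCycles (C : Configuration 9 3) (P : CyclePartition C 2) where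
  open Configuration C
  open CyclePartition P
  open Cycles C P
  open Intersections C
  open NineThree C

  -- The length of a cycle is known only up to a propositional equality, while the arguments on
  -- short cycles compute with numerals as indices.
  record Reindexed (c : Fin 2) (ℓ : ℕ) : Set where
    field
      f           : Fin ℓ → Fin 9
      f-injective : Injective _≡_ _≡_ f
      f-successor : ∀ t → successor (f t) ≡ f (next t)
      f-predecessor : ∀ t → predecessor (f t) ≡ f (prev t)
      f-cycle     : ∀ t → ∃[ s ] f t ≡ cycle c s

  reindex : ∀ c {ℓ} → length c ≡ ℓ → Reindexed c ℓ
  reindex c refl = record { f = cycle c ; f-injective = cycle-injective ; f-successor = successor-cycle c
                          ; f-predecessor = predecessor-cycle c ; f-cycle = λ t → t , refl }
  open Reindexed

  meet′ : ∀ {i j} → i ≢ j → successor i ≢ j → predecessor i ≢ j → Meet i j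
  meet′ = meet refl ∥-successor ∥-predecessor i≢successor i≢predecessor successor≢predecessor

  module _ {c d k ℓ} (c≢d : c ≢ d) (R : Reindexed c k) (S : Reindexed d ℓ) where

    disjoint : ∀ s t → f R s ≢ f S t
    disjoint s t eq = let s′ , eqs = f-cycle R s ; t′ , eqt = f-cycle S t in
      c≢d (cong proj₁ (proj₁ partition (trans (sym eqs) (trans eq eqt))))

    meet-other : ∀ s t → Meet (f R s) (f S t)
    meet-other s t = meet′ (disjoint s t) (λ eq → disjoint (next s) t (trans (sym (f-successor R s)) eq))
      (λ eq → disjoint (prev s) t (trans (sym (f-predecessor R s)) eq))

  meet-same : ∀ {c k} (R : Reindexed c k) s t → s ≢ t → next s ≢ t → prev s ≢ t → Meet (f R s) (f R t)
  meet-same R s t s≢t ns≢t ps≢t = meet′ (s≢t ∘ f-injective R)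
    (λ eq → ns≢t (f-injective R (trans (sym (f-successor R s)) eq)))
    (λ eq → ps≢t (f-injective R (trans (sym (f-predecessor R s)) eq)))

  consecutive-∥ : ∀ {c k} (R : Reindexed c k) t → Parallel (f R t) (f R (next t))
  consecutive-∥ R t = subst (Parallel (f R t)) (f-successor R t) (∥-successor (f R t))

  triangle-∥ : ∀ {c} (R : Reindexed c 3) {s t} → s ≢ t → Parallel (f R s) (f R t)
  triangle-∥ R {s} {t} s≢t with next-or-prev s t s≢t
    where
    next-or-prev : ∀ (s t : Fin 3) → s ≢ t → t ≡ next s ⊎ s ≡ next t
    next-or-prev = toWitness {a? = all? λ s → all? λ t → ¬? (s ≟ t) →-dec ((t ≟ next s) ⊎-dec (s ≟ next t))} _
  ... | inj₁ refl = consecutive-∥ R s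
  ... | inj₂ refl = ∥-sym (consecutive-∥ R t)

  hexagon : ∀ {c d} → c ≢ d → Reindexed c 3 → Reindexed d 6 → Isomorphic C configuration9·1
  hexagon c≢d R S = Hexagon.isomorphic (f R) (f S) (f-injective R) (f-injective S) (disjoint c≢d R S)
    (triangle-∥ R) (λ s t → meet-other (≢-sym c≢d) S R t s) (meet-same S)

  quadrilateral : ∀ {c d} → c ≢ d → Reindexed c 4 → ¬ Reindexed d 5
  -- Three of the five lines in the other cycle already exceed the room for two.
  quadrilateral c≢d R S = no-quadrilateral (f R) (f S ∘ (_↑ˡ 2)) (f-injective R) (Fin.↑ˡ-injective 2 _ _ ∘ f-injective S)
    (λ s t → disjoint c≢d R S s (t ↑ˡ 2)) (consecutive-∥ R) (λ s t → meet-other (≢-sym c≢d) S R (t ↑ˡ 2) s)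
    (meet-same R 0F 2F (λ ()) (λ ()) (λ ())) (meet-same R 1F 3F (λ ()) (λ ()) (λ ()))

  isomorphic : Isomorphic C configuration9·1
  isomorphic with split-9 (length 0F) (length 1F) (length≥3 0F) (length≥3 1F) sum-lengths
  ... | inj₁ (eq₀ , eq₁)               = hexagon {0F} {1F} (λ ()) (reindex 0F eq₀) (reindex 1F eq₁)
  ... | inj₂ (inj₁ (eq₀ , eq₁))        = ⊥-elim (quadrilateral {0F} {1F} (λ ()) (reindex 0F eq₀) (reindex 1F eq₁))
  ... | inj₂ (inj₂ (inj₁ (eq₀ , eq₁))) = ⊥-elim (quadrilateral {1F} {0F} (λ ()) (reindex 1F eq₁) (reindex 0F eq₀))
  ... | inj₂ (inj₂ (inj₂ (eq₀ , eq₁))) = hexagon {1F} {0F} (λ ()) (reindex 1F eq₁) (reindex 0F eq₀)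

3m≤v : ∀ {v r m} {C : Configuration v r} → CyclePartition C m → m * 3 ≤ v
3m≤v {m = m} {C} P = subst (m * 3 ≤_) (Cycles.sum-lengths C P) (sum-tabulate-≥ (CyclePartition.length P) (CyclePartition.length≥3 P))

theorem6p1 : (n : ℕ) → 1 ≤ n →
    (C : Configuration (n ^ 2 + n + 3) (n + 1)) →
    (m : ℕ) → CyclePartition C m →
    Isomorphic C configuration9·1 ⊎ (∃[ k ] m ≡ 2 * k + 1)
theorem6p1 n 1≤n C m P with odd-or-even m
... | inj₁ odd = inj₂ odd
-- Without cycles the lengths would add up to 0, but v = n² + n + 3.
... | inj₂ (zero , refl) = contradiction (trans (sym (Cycles.sum-lengths C P)) refl) (m+1+n≢0 (n ^ 2 + n))
-- Here v = 5, while two cycles take at least six lines.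
theorem6p1 1 1≤n C m P | inj₂ (suc t , refl) = contradiction (3m≤v P) (<⇒≱ (≤-trans (≤-reflexive refl) (*-monoˡ-≤ 3 (*-monoʳ-≤ 2 (s≤s (z≤n {t}))))))
theorem6p1 2 1≤n C m P | inj₂ (1 , refl) = inj₁ (TwoCycles.isomorphic C P)
-- Here v = 9, while four cycles take at least twelve lines.
theorem6p1 2 1≤n C m P | inj₂ (suc (suc t) , refl) = contradiction (3m≤v P) (<⇒≱ (≤-trans (m≤m+n 10 2) (*-monoˡ-≤ 3 (*-monoʳ-≤ 2 (s≤s (s≤s (z≤n {t})))))))
theorem6p1 (suc (suc (suc k))) 1≤n C m P | inj₂ (t@(suc _) , m≡) = let h , v≡ = n²+n+3-odd (3 + k) in
  ⊥-elim (GramComparison.m-not-even k C (deficiency (3 + k)) (+-comm (3 + k) 1) P h t v≡ m≡)
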